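{- Consider the non-adaptive model with two-phase algorithm strategies: the algorithm chooses $u\in\{T^aE^{n-a}:0\le a\le n\}$ and then the adversary, knowing $u$, chooses $v\in\{p,x\}^n$, the resulting ratio being $\mathrm{ALG}(u,v)/\mathrm{OPT}(v)$. There is a procedure which, given the number of jobs $n$ and the parameters $p,x>0$, computes in time $O(n^2)$ the equilibrium schedule, and therefore the optimal algorithm's strategy, i.e. an $a\in\{0,\dots,n\}$ minimizing $\max_{v\in\{p,x\}^n}\mathrm{ALG}(T^aE^{n-a},v)/\mathrm{OPT}(v)$.
   Context: There are $n$ jobs, numbered $1,\dots,n$, to be scheduled on a single machine so as to minimize the sum of completion times. Each job is either short (processing time $p$) or long (processing time $p+x$), where $p,x>0$ are known numbers; which jobs are long is initially unknown to the algorithm. Jobs are handled in index order. For each job $j$ the algorithm either tests it ($u_j=T$; the test takes one time unit on the machine and reveals the processing time; a tested short job is executed immediately after its test, a tested long job is postponed to the end of the schedule) or executes it untested ($u_j=E$). The adversary decides whether job $j$ is short ($v_j=p$) or long ($v_j=x$); here $T,E,p,x$ are used as symbols in the strategy strings. For $u\in\{T,E\}^n$, $v\in\{p,x\}^n$, the cost $\mathrm{ALG}(u,v)$ (total completion time of the schedule) is obtained as follows. Start with $A=p\,n(n+1)/2$ and $r=n$. For $j=1,\dots,n$: if $u_j=E,v_j=p$, decrease $r$ by $1$; if $u_j=E,v_j=x$, add $rx$ to $A$ and then decrease $r$ by $1$; if $u_j=T,v_j=p$, add $r$ to $A$ and then decrease $r$ by $1$; if $u_j=T,v_j=x$, add $r$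 to $A$. Finally add $x\,r(r+1)/2$ to $A$; the result is $\mathrm{ALG}(u,v)$. With $\ell=|\{j:v_j=x\}|$, the optimal cost is $\mathrm{OPT}(v)=\bigl(p\,n(n+1)+x\,\ell(\ell+1)\bigr)/2$. The algorithm minimizes and the adversary maximizes the ratio. A schedule is described by the string $u_1v_1u_2v_2\cdots u_nv_n$; the equilibrium schedule is the one obtained when both players play optimally. Running time counts elementary arithmetic operations (including comparison and rounding) on numbers as unit cost. -}

module Defs where

open import Level as L using (Level; _⊔_)
open import Data.Nat.Base as ℕ using (ℕ; zero)
open import Data.Integer.Base as ℤ using (ℤ; +_; -[1+_]; ∣_∣)
open import Data.Fin.Base using (Fin; zero; suc)
open import Data.Bool.Base using (if_then_else_)
open import Data.List.Base using (List; []; _∷_; _∷ʳ_)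
open import Data.Product.Base using (_×_)
open import Data.Sum.Base using (_⊎_; inj₁; inj₂)
open import Data.Vec.Base using (Vec; []; _∷_; replicate; count)
open import Relation.Nullary.Decidable.Core using (Dec; yes; no)
open import Relation.Nullary.Negation.Core using (¬_)
open import Relation.Binary.Core using (Rel)
open import Relation.Binary.Bundles using (StrictTotalOrder; DecTotalOrder)
open import Relation.Binary.Structures using (IsStrictTotalOrder)
open import Relation.Binary.PropositionalEquality.Core using (_≡_; refl)
open import Algebra.Bundles using (CommutativeRing)
import Algebra.Definitions.RawMonoid as Mult
import Algebra.Construct.NaturalChoice.Max as Max
import Relation.Binary.Properties.StrictTotalOrder as STO

------------------------------------------------------------------------
-- Numbers

module Embedding {c ℓ} (R : CommutativeRing c ℓ) where

  open CommutativeRing R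

  open Mult +-rawMonoid using () renaming (_×_ to _×ℕ_)

  fromℕ : ℕ → Carrier
  fromℕ n = n ×ℕ 1#

  fromℤ : ℤ → Carrier
  fromℤ (+ n)    = fromℕ n
  fromℤ -[1+ n ] = - fromℕ (ℕ.suc n)

-- The numbers are the elements of an ordered field with decidable order
-- and a rounding function.  The existence of ⌊_⌋ makes the field
-- Archimedean, so that classically these are exactly the subfields of
-- the real numbers, with the reals themselves as the main instance.

record OrderedField (c ℓ₁ ℓ₂ : Level) : Set (L.suc (c ⊔ ℓ₁ ⊔ ℓ₂)) where
  field
    commutativeRing : CommutativeRing c ℓ₁

  open CommutativeRing commutativeRing public
  open Embedding commutativeRing public

  infix  4 _<_
  infix  8 _⁻¹

  field
    _<_                : Rel Carrier ℓ₂
    isStrictTotalOrder : IsStrictTotalOrder _≈_ _<_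
    0<1                : 0# < 1#
    +-monoˡ-<          : ∀ z {x y} → x < y → x + z < y + z
    *-pos              : ∀ {x y} → 0# < x → 0# < y → 0# < x * y
    -- total, with an unspecified value at 0#
    _⁻¹                : Carrier → Carrier
    ⁻¹-cong            : ∀ {x y} → x ≈ y → x ⁻¹ ≈ y ⁻¹
    ⁻¹-inverseʳ        : ∀ x → ¬ (x ≈ 0#) → x * x ⁻¹ ≈ 1#

  strictTotalOrder : StrictTotalOrder c ℓ₁ ℓ₂
  strictTotalOrder = record { isStrictTotalOrder = isStrictTotalOrder }

  decTotalOrder : DecTotalOrder c ℓ₁ (ℓ₁ ⊔ ℓ₂)
  decTotalOrder = STO.decTotalOrder strictTotalOrder

  open DecTotalOrder decTotalOrder public using (_≤_; totalOrder)

  open Max totalOrder public using () renaming (_⊔_ to max)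

  field
    ⌊_⌋      : Carrier → ℤ
    ⌊⌋-lower : ∀ x → fromℤ ⌊ x ⌋ ≤ x
    ⌊⌋-upper : ∀ x → x < fromℤ ⌊ x ⌋ + 1#

  infixl 7 _÷_

  _÷_ : Carrier → Carrier → Carrier
  y ÷ z = y * z ⁻¹

------------------------------------------------------------------------
-- Strategies and schedules

data Action : Set where
  T E : Action

data Kind : Set where
  short long : Kind

-- The letters of schedule strings: short and long stand for the
-- adversary's letters p and x.

Symbol : Set
Symbol = Action ⊎ Kind

schedule : ∀ {n} → Vec Action n → Vec Kind n → List Symbol
schedule []       []       = []
schedule (u ∷ us) (v ∷ vs) = inj₁ u ∷ inj₂ v ∷ schedule us vs

-- T^a E^(n-a)

twoPhase : ∀ n → Fin (ℕ.suc n) → Vec Action n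
twoPhase n         zero    = replicate n E
twoPhase (ℕ.suc n) (suc a) = T ∷ twoPhase n a

long? : (k : Kind) → Dec (k ≡ long)
long? short = no λ ()
long? long  = yes refl

#long : ∀ {n} → Vec Kind n → ℕ
#long = count long?

------------------------------------------------------------------------
-- The game

module Game {c ℓ₁ ℓ₂} (F : OrderedField c ℓ₁ ℓ₂)
            (p x : OrderedField.Carrier F) where

  open OrderedField F hiding (zero)

  private
    2# : Carrier
    2# = fromℕ 2

  -- The cost still to be accounted for is added to the accumulator A;
  -- r is the number of jobs not yet executed.

  run : ∀ {n} → Vec Action n → Vec Kind n → (A : Carrier) (r : ℕ) → Carrier
  run []       []           A r = A + x * fromℕ (r ℕ.* (r ℕ.+ 1)) ÷ 2#
  run (E ∷ us) (short ∷ vs) A r = run us vs A (r ℕ.∸ 1)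
  run (E ∷ us) (long  ∷ vs) A r = run us vs (A + fromℕ r * x) (r ℕ.∸ 1)
  run (T ∷ us) (short ∷ vs) A r = run us vs (A + fromℕ r) (r ℕ.∸ 1)
  run (T ∷ us) (long  ∷ vs) A r = run us vs (A + fromℕ r) r

  ALG : ∀ {n} → Vec Action n → Vec Kind n → Carrier
  ALG {n} u v = run u v (p * fromℕ (n ℕ.* (n ℕ.+ 1)) ÷ 2#) n

  OPT : ∀ {n} → Vec Kind n → Carrier
  OPT {n} v =
    (p * fromℕ (n ℕ.* (n ℕ.+ 1)) + x * fromℕ (ℓ ℕ.* (ℓ ℕ.+ 1))) ÷ 2#
    where ℓ = #long v

  ratio : ∀ {n} → Vec Action n → Vec Kind n → Carrier
  ratio u v = ALG u v ÷ OPT v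

  maximum : ∀ n → (Vec Kind n → Carrier) → Carrier
  maximum zero      f = f []
  maximum (ℕ.suc n) f = max (maximum n λ v → f (short ∷ v))
                            (maximum n λ v → f (long  ∷ v))

  worstRatio : ∀ {n} → Vec Action n → Carrier
  worstRatio {n} u = maximum n (ratio u)

  OptimalAlgorithm : ∀ n → Fin (ℕ.suc n) → Set (ℓ₁ ⊔ ℓ₂)
  OptimalAlgorithm n a =
    ∀ a′ → worstRatio (twoPhase n a) ≤ worstRatio (twoPhase n a′)

  BestResponse : ∀ {n} → Vec Action n → Vec Kind n → Set (ℓ₁ ⊔ ℓ₂)
  BestResponse u v = ∀ v′ → ratio u v′ ≤ ratio u v

  Equilibrium : ∀ n → Fin (ℕ.suc n) → Vec Kind n → Set (ℓ₁ ⊔ ℓ₂)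
  Equilibrium n a v = OptimalAlgorithm n a × BestResponse (twoPhase n a) v

------------------------------------------------------------------------
-- Programs of a random-access machine with unit-cost arithmetic

-- Programs are finite syntax and do not depend on the field, on n, or on
-- p and x, so that every operation they use is accounted for.

infixl 6 _⊕_ _⊖_
infixl 7 _⊛_ _⊘_

data Expr : Set where
  lit             : ℕ → Expr
  cell            : ℕ → Expr
  cellAt          : Expr → Expr        -- indirect addressing
  _⊕_ _⊖_ _⊛_ _⊘_ : Expr → Expr → Expr
  floor           : Expr → Expr

infix 4 _⊲_

data Guard : Set where
  _⊲_ : Expr → Expr → Guard

infixr 5 _⨾_

data Program : Set where
  skip  : Program
  put   : ℕ → Expr → Program
  putAt : Expr → Expr → Program        -- indirect addressing
  emit  : Symbol → Program
  _⨾_   : Program → Program → Program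
  if    : Guard → Program → Program → Program
  while : Guard → Program → Program

-- Every node of an expression takes one time unit, including
-- constants and memory accesses.

costᵉ : Expr → ℕ
costᵉ (lit k)    = 1
costᵉ (cell i)   = 1
costᵉ (cellAt e) = 1 ℕ.+ costᵉ e
costᵉ (d ⊕ e)    = 1 ℕ.+ costᵉ d ℕ.+ costᵉ e
costᵉ (d ⊖ e)    = 1 ℕ.+ costᵉ d ℕ.+ costᵉ e
costᵉ (d ⊛ e)    = 1 ℕ.+ costᵉ d ℕ.+ costᵉ e
costᵉ (d ⊘ e)    = 1 ℕ.+ costᵉ d ℕ.+ costᵉ e
costᵉ (floor e)  = 1 ℕ.+ costᵉ e

costᵍ : Guard → ℕ
costᵍ (d ⊲ e) = 1 ℕ.+ costᵉ d ℕ.+ costᵉ e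

module Machine {c ℓ₁ ℓ₂} (F : OrderedField c ℓ₁ ℓ₂) where

  open OrderedField F hiding (zero)

  Memory : Set c
  Memory = ℕ → Carrier

  record State : Set c where
    constructor ⟪_,_⟫
    field
      memory : Memory
      output : List Symbol

  open State public

  infixl 9 _[_≔_]

  _[_≔_] : Memory → ℕ → Carrier → Memory
  (m [ i ≔ y ]) j = if i ℕ.≡ᵇ j then y else m j

  -- The cell denoted by a number used as an address; programs are only
  -- expected to use natural numbers here.

  address : Carrier → ℕ
  address y = ∣ ⌊ y ⌋ ∣

  ⟦_⟧ : Expr → Memory → Carrier
  ⟦ lit k ⟧    m = fromℕ k
  ⟦ cell i ⟧   m = m i
  ⟦ cellAt e ⟧ m = m (address (⟦ e ⟧ m))
  ⟦ d ⊕ e ⟧    m = ⟦ d ⟧ m + ⟦ e ⟧ m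
  ⟦ d ⊖ e ⟧    m = ⟦ d ⟧ m - ⟦ e ⟧ m
  ⟦ d ⊛ e ⟧    m = ⟦ d ⟧ m * ⟦ e ⟧ m
  ⟦ d ⊘ e ⟧    m = ⟦ d ⟧ m ÷ ⟦ e ⟧ m
  ⟦ floor e ⟧  m = fromℤ ⌊ ⟦ e ⟧ m ⌋

  Holds : Guard → Memory → Set ℓ₂
  Holds (d ⊲ e) m = ⟦ d ⟧ m < ⟦ e ⟧ m

  -- Started in s, P halts in s′ after exactly t time units.

  infix 3 _∶_⇓_time_

  data _∶_⇓_time_ : Program → State → State → ℕ → Set (c ⊔ ℓ₂) where

    skip : ∀ {s} → skip ∶ s ⇓ s time 0

    put : ∀ {i e m o} →
      put i e ∶ ⟪ m , o ⟫ ⇓ ⟪ m [ i ≔ ⟦ e ⟧ m ] , o ⟫ time 1 ℕ.+ costᵉ e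

    putAt : ∀ {d e m o} →
      putAt d e ∶ ⟪ m , o ⟫ ⇓ ⟪ m [ address (⟦ d ⟧ m) ≔ ⟦ e ⟧ m ] , o ⟫
        time 1 ℕ.+ costᵉ d ℕ.+ costᵉ e

    emit : ∀ {a m o} → emit a ∶ ⟪ m , o ⟫ ⇓ ⟪ m , o ∷ʳ a ⟫ time 1

    _⨾_ : ∀ {P Q s s′ s″ t t′} →
      P ∶ s ⇓ s′ time t → Q ∶ s′ ⇓ s″ time t′ →
      P ⨾ Q ∶ s ⇓ s″ time t ℕ.+ t′

    if-true : ∀ {g P Q s s′ t} →
      Holds g (memory s) → P ∶ s ⇓ s′ time t →
      if g P Q ∶ s ⇓ s′ time costᵍ g ℕ.+ t

    if-false : ∀ {g P Q s s′ t} →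
      ¬ Holds g (memory s) → Q ∶ s ⇓ s′ time t →
      if g P Q ∶ s ⇓ s′ time costᵍ g ℕ.+ t

    while-true : ∀ {g P s s′ s″ t t′} →
      Holds g (memory s) →
      P ∶ s ⇓ s′ time t → while g P ∶ s′ ⇓ s″ time t′ →
      while g P ∶ s ⇓ s″ time costᵍ g ℕ.+ t ℕ.+ t′

    while-false : ∀ {g P s} →
      ¬ Holds g (memory s) →
      while g P ∶ s ⇓ s time costᵍ g

  -- Input convention: n, p, x in cells 0, 1, 2 and 0 everywhere else.

  initial : ℕ → Carrier → Carrier → State
  initial n p x =
    ⟪ (λ { 0 → fromℕ n ; 1 → p ; 2 → x ; _ → 0# }) , [] ⟫

{-# OPTIONS --safe #-}

-- Let k and m be the numbers of long jobs among the a tested and the n − a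
-- untested jobs.  For fixed k and m the algorithm suffers most when the long
-- jobs come first in both phases, and then ALG exceeds OPT by
--
--   a n − (a − k)(a − k − 1)/2 + x m (n − a − m),
--
-- while OPT depends on k + m only.  Along a line k + m = ℓ this excess is a
-- concave quadratic, so its maximum is characterised by comparison with the
-- two neighbours, and a maximiser for ℓ + 1 arises from one for ℓ by
-- increasing k or m by one; which of them is decided by a single comparison.
-- Hence the best replies to all a are found in O(n) steps each.

module Submission where

open import Defs
open import Level using (_⊔_; Lift; lift)
open import Data.Bool.Base using (true; false)
open import Data.Empty using (⊥)
open import Data.Unit.Base using (⊤; tt)
open import Data.Nat.Base as ℕ using (ℕ; zero; suc)
import Data.Nat.Properties as ℕ
open import Data.Nat.Tactic.RingSolver using (solve-∀)
open import Data.Integer.Base as ℤ using (ℤ; +_; -[1+_])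
import Data.Integer.Properties as ℤ
open import Data.Fin.Base using (Fin; zero; suc; toℕ; fromℕ<)
import Data.Fin.Properties as Fin
open import Data.List.Base using (List; []; _∷_; _++_; _∷ʳ_)
import Data.List.Properties as List
open import Data.Maybe.Base using (Maybe; just; nothing)
open import Data.Product.Base using (_×_; _,_; ∃₂; ∃-syntax)
open import Data.Sum.Base using (_⊎_; inj₁; inj₂)
open import Data.Vec.Base using (Vec; []; _∷_; replicate)
open import Data.Vec.Properties using (count≤n)
open import Function.Base using (_∘_)
open import Relation.Nullary using (¬_; yes; no; contradiction)
open import Relation.Binary.Bundles using (StrictTotalOrder; DecTotalOrder)
open import Relation.Binary.Definitions using (tri<; tri≈; tri>)
open import Relation.Binary.PropositionalEquality as ≡ using (_≡_)
import Algebra.Construct.NaturalChoice.Max as Max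
import Algebra.Properties.Ring as RingProperties
import Algebra.Properties.Semiring.Mult as Mult
import Algebra.Properties.Semiring.Mult.TCOptimised as Mult′
import Algebra.Solver.Ring as Solver
open import Algebra.Solver.Ring.AlmostCommutativeRing
  using (fromCommutativeRing; _-Raw-AlmostCommutative⟶_)

-- A short job ahead of M untested long ones costs the adversary x M, and a tested short job ahead
-- of K tested long ones costs K; so only the pair (k, m) matters, and the ratio minus 1 is the
-- excess over OPT divided by OPT. One comparison per step suffices because optimality on a line is
-- two inequalities (`Balanced`), one for each direction of exchange. Raising k preserves one of
-- them, raising m preserves the other, and the one not preserved is exactly the comparison of (k +
-- 1, m) with (k, m + 1). The constraint m ≤ n - a needs no check by the program: once all n - a
-- untested jobs are long, the gain of a further one is negative, so the comparison never asks for
-- it. Every value is a closed form of fixed size in the memory cells. Hence each of the (n + 1)²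
-- pairs (a, ℓ) takes constant time, and since all cells but the printing counters have literal
-- addresses, lookups after writes reduce by computation.

module OrderedFieldProperties {c ℓ₁ ℓ₂} (F : OrderedField c ℓ₁ ℓ₂) where

  open OrderedField F hiding (zero)
  open StrictTotalOrder strictTotalOrder public
    using (compare; _<?_; strictPartialOrder)
    renaming (trans to <-trans; irrefl to <-irrefl; asym to <-asym;
              <-respʳ-≈ to <-respʳ; <-respˡ-≈ to <-respˡ)
  open DecTotalOrder decTotalOrder public
    using () renaming (refl to ≤-refl; trans to ≤-trans; reflexive to ≤-reflexive)
  open RingProperties ring
  open Mult semiring using (×-homo-+; ×1-homo-*)
  open Mult′ semiring using (×ᵤ≈×) renaming (_×_ to _×′_)

  module ≤-Reasoning where
    open import Relation.Binary.Reasoning.StrictPartialOrder strictPartialOrder public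

  open ≤-Reasoning

  -- Naturals and integers in the field, and a ring solver with integer coefficients.

  fromℕ-+ : ∀ m n → fromℕ (m ℕ.+ n) ≈ fromℕ m + fromℕ n
  fromℕ-+ = ×-homo-+ 1#

  fromℕ-* : ∀ m n → fromℕ (m ℕ.* n) ≈ fromℕ m * fromℕ n
  fromℕ-* = ×1-homo-*

  fromℤ-⊖ : ∀ m n → fromℤ (m ℤ.⊖ n) ≈ fromℕ m - fromℕ n
  fromℤ-⊖ zero    zero    = sym (-‿inverseʳ 0#)
  fromℤ-⊖ zero    (suc n) = sym (+-identityˡ _)
  fromℤ-⊖ (suc m) zero    = sym (trans (+-congˡ -0#≈0#) (+-identityʳ _))
  fromℤ-⊖ (suc m) (suc n) = begin-equality
    fromℤ (suc m ℤ.⊖ suc n)            ≡⟨ ≡.cong fromℤ (ℤ.[1+m]⊖[1+n]≡m⊖n m n) ⟩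
    fromℤ (m ℤ.⊖ n)                    ≈⟨ fromℤ-⊖ m n ⟩
    fromℕ m - fromℕ n                  ≈⟨ +-congʳ (+-identityʳ _) ⟨
    fromℕ m + 0# - fromℕ n             ≈⟨ +-congʳ (+-congˡ (-‿inverseʳ 1#)) ⟨
    fromℕ m + (1# - 1#) - fromℕ n      ≈⟨ +-congʳ (+-assoc _ _ _) ⟨
    fromℕ m + 1# - 1# - fromℕ n        ≈⟨ +-congʳ (+-congʳ (+-comm _ _)) ⟩
    1# + fromℕ m - 1# - fromℕ n        ≈⟨ +-assoc _ _ _ ⟩
    1# + fromℕ m + (- 1# - fromℕ n)    ≈⟨ +-congˡ (-‿+-comm _ _) ⟩
    fromℕ (suc m) - fromℕ (suc n)      ∎

  fromℤ-neg : ∀ i → fromℤ (ℤ.- i) ≈ - fromℤ i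
  fromℤ-neg (+ zero)  = sym -0#≈0#
  fromℤ-neg (+ suc n) = refl
  fromℤ-neg -[1+ n ]  = sym (-‿involutive _)

  fromℤ-+ : ∀ i j → fromℤ (i ℤ.+ j) ≈ fromℤ i + fromℤ j
  fromℤ-+ (+ m)    (+ n)    = fromℕ-+ m n
  fromℤ-+ (+ m)    -[1+ n ] = fromℤ-⊖ m (suc n)
  fromℤ-+ -[1+ m ] (+ n)    = trans (fromℤ-⊖ n (suc m)) (+-comm _ _)
  fromℤ-+ -[1+ m ] -[1+ n ] = begin-equality
    - fromℕ (suc (suc (m ℕ.+ n)))        ≡⟨ ≡.cong (-_ ∘ fromℕ) (≡.sym (ℕ.+-suc (suc m) n)) ⟩
    - fromℕ (suc m ℕ.+ suc n)            ≈⟨ -‿cong (fromℕ-+ (suc m) (suc n)) ⟩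
    - (fromℕ (suc m) + fromℕ (suc n))    ≈⟨ -‿+-comm _ _ ⟨
    - fromℕ (suc m) - fromℕ (suc n)      ∎

  fromℤ-*⁺ : ∀ m j → fromℤ (+ m ℤ.* j) ≈ fromℕ m * fromℤ j
  fromℤ-*⁺ m (+ n) = trans (reflexive (≡.cong fromℤ (≡.sym (ℤ.pos-* m n)))) (fromℕ-* m n)
  fromℤ-*⁺ m -[1+ n ] = begin-equality
    fromℤ (+ m ℤ.* -[1+ n ])        ≡⟨ ≡.cong fromℤ (ℤ.neg-distribʳ-* (+ m) (+ suc n)) ⟨
    fromℤ (ℤ.- (+ m ℤ.* + suc n))   ≈⟨ fromℤ-neg (+ m ℤ.* + suc n) ⟩
    - fromℤ (+ m ℤ.* + suc n)       ≈⟨ -‿cong (fromℤ-*⁺ m (+ suc n)) ⟩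
    - (fromℕ m * fromℕ (suc n))     ≈⟨ -‿distribʳ-* _ _ ⟩
    fromℕ m * - fromℕ (suc n)       ∎

  fromℤ-* : ∀ i j → fromℤ (i ℤ.* j) ≈ fromℤ i * fromℤ j
  fromℤ-* (+ m)    j = fromℤ-*⁺ m j
  fromℤ-* -[1+ m ] j = begin-equality
    fromℤ (-[1+ m ] ℤ.* j)          ≡⟨ ≡.cong fromℤ (ℤ.neg-distribˡ-* (+ suc m) j) ⟨
    fromℤ (ℤ.- (+ suc m ℤ.* j))     ≈⟨ fromℤ-neg (+ suc m ℤ.* j) ⟩
    - fromℤ (+ suc m ℤ.* j)         ≈⟨ -‿cong (fromℤ-*⁺ (suc m) j) ⟩
    - (fromℕ (suc m) * fromℤ j)     ≈⟨ -‿distribˡ-* _ _ ⟩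
    - fromℕ (suc m) * fromℤ j       ∎

  -- fromℤ with ι (+ 1) = 1# definitionally, so that the constant 1 of the
  -- solver below denotes 1# rather than 1# + 0#.

  ι : ℤ → Carrier
  ι (+ n)    = n ×′ 1#
  ι -[1+ n ] = - (suc n ×′ 1#)

  ι≈fromℤ : ∀ i → ι i ≈ fromℤ i
  ι≈fromℤ (+ n)    = sym (×ᵤ≈× n 1#)
  ι≈fromℤ -[1+ n ] = -‿cong (sym (×ᵤ≈× (suc n) 1#))

  ι-morphism : ℤ.+-*-rawRing -Raw-AlmostCommutative⟶ fromCommutativeRing commutativeRing
  ι-morphism = record
    { ⟦_⟧    = ι
    ; +-homo = λ i j → trans (ι≈fromℤ (i ℤ.+ j))
        (trans (fromℤ-+ i j) (sym (+-cong (ι≈fromℤ i) (ι≈fromℤ j))))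
    ; *-homo = λ i j → trans (ι≈fromℤ (i ℤ.* j))
        (trans (fromℤ-* i j) (sym (*-cong (ι≈fromℤ i) (ι≈fromℤ j))))
    ; -‿homo = λ i → trans (ι≈fromℤ (ℤ.- i))
        (trans (fromℤ-neg i) (sym (-‿cong (ι≈fromℤ i))))
    ; 0-homo = refl
    ; 1-homo = refl
    }

  ι-≟ : ∀ i j → Maybe (ι i ≈ ι j)
  ι-≟ i j with i ℤ.≟ j
  ... | yes i≡j = just (reflexive (≡.cong ι i≡j))
  ... | no  _   = nothing

  module RingSolver =
    Solver ℤ.+-*-rawRing (fromCommutativeRing commutativeRing) ι-morphism ι-≟

  open RingSolver

  -- Inequalities in the ordered field.

  <⇒≤ : ∀ {x y} → x < y → x ≤ y
  <⇒≤ = inj₁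

  ≮⇒≥ : ∀ {x y} → ¬ (x < y) → y ≤ x
  ≮⇒≥ {x} {y} x≮y with compare x y
  ... | tri< x<y _ _ = contradiction x<y x≮y
  ... | tri≈ _ x≈y _ = inj₂ (sym x≈y)
  ... | tri> _ _ y<x = inj₁ y<x

  ≤⇒≯ : ∀ {x y} → x ≤ y → ¬ (y < x)
  ≤⇒≯ (inj₁ x<y) y<x = <-asym x<y y<x
  ≤⇒≯ (inj₂ x≈y) y<x = <-irrefl (sym x≈y) y<x

  +-monoˡ-≤ : ∀ z {x y} → x ≤ y → x + z ≤ y + z
  +-monoˡ-≤ z (inj₁ x<y) = inj₁ (+-monoˡ-< z x<y)
  +-monoˡ-≤ z (inj₂ x≈y) = inj₂ (+-congʳ x≈y)

  +-monoʳ-≤ : ∀ z {x y} → x ≤ y → z + x ≤ z + y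
  +-monoʳ-≤ z {x} {y} x≤y = begin
    z + x  ≈⟨ +-comm z x ⟩
    x + z  ≤⟨ +-monoˡ-≤ z x≤y ⟩
    y + z  ≈⟨ +-comm y z ⟩
    z + y  ∎

  0≤+ : ∀ {x y} → 0# ≤ x → 0# ≤ y → 0# ≤ x + y
  0≤+ {x} {y} 0≤x 0≤y = begin
    0#      ≤⟨ 0≤x ⟩
    x       ≈⟨ +-identityʳ x ⟨
    x + 0#  ≤⟨ +-monoʳ-≤ x 0≤y ⟩
    x + y   ∎

  0≤* : ∀ {x y} → 0# ≤ x → 0# ≤ y → 0# ≤ x * y
  0≤* (inj₁ 0<x) (inj₁ 0<y) = inj₁ (*-pos 0<x 0<y)
  0≤* {x} {y} (inj₂ 0≈x) _  = inj₂ (trans (sym (zeroˡ y)) (*-congʳ 0≈x))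
  0≤* {x} {y} _ (inj₂ 0≈y)  = inj₂ (trans (sym (zeroʳ x)) (*-congˡ 0≈y))

  0<+ : ∀ {x y} → 0# < x → 0# ≤ y → 0# < x + y
  0<+ {x} {y} 0<x 0≤y = begin-strict
    0#      <⟨ 0<x ⟩
    x       ≈⟨ +-identityʳ x ⟨
    x + 0#  ≤⟨ +-monoʳ-≤ x 0≤y ⟩
    x + y   ∎

  -- Exhibiting the difference `d` splits an inequality into a sign condition and an equation, which
  -- is usually left to the solver.
  ≤-gap : ∀ {x y} d → 0# ≤ d → x + d ≈ y → x ≤ y
  ≤-gap {x} {y} d 0≤d x+d≈y = begin
    x       ≈⟨ +-identityʳ x ⟨
    x + 0#  ≤⟨ +-monoʳ-≤ x 0≤d ⟩
    x + d   ≈⟨ x+d≈y ⟩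
    y       ∎

  0≤- : ∀ {x y} → x ≤ y → 0# ≤ y - x
  0≤- {x} {y} x≤y = begin
    0#     ≈⟨ -‿inverseʳ x ⟨
    x - x  ≤⟨ +-monoˡ-≤ (- x) x≤y ⟩
    y - x  ∎

  *-monoʳ-≤ : ∀ {x y z} → 0# ≤ z → x ≤ y → x * z ≤ y * z
  *-monoʳ-≤ {x} {y} {z} 0≤z x≤y = ≤-gap ((y - x) * z) (0≤* (0≤- x≤y) 0≤z)
    (solve 3 (λ x y z → x :* z :+ (y :- x) :* z := y :* z) refl x y z)

  0<⁻¹ : ∀ {x} → 0# < x → 0# < x ⁻¹
  0<⁻¹ {x} 0<x with compare 0# (x ⁻¹)
  ... | tri< 0<x⁻¹ _ _ = 0<x⁻¹
  ... | tri≈ _ 0≈x⁻¹ _ = contradiction 0<1 (<-irrefl (begin-equality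
    0#        ≈⟨ zeroʳ x ⟨
    x * 0#    ≈⟨ *-congˡ 0≈x⁻¹ ⟩
    x * x ⁻¹  ≈⟨ ⁻¹-inverseʳ x (λ x≈0 → <-irrefl (sym x≈0) 0<x) ⟩
    1#        ∎))
  ... | tri> _ _ x⁻¹<0 = contradiction 0<1 (≤⇒≯ (begin
    1#                  ≈⟨ ⁻¹-inverseʳ x (λ x≈0 → <-irrefl (sym x≈0) 0<x) ⟨
    x * x ⁻¹            ≤⟨ ≤-gap (x * (0# - x ⁻¹)) (0≤* (<⇒≤ 0<x) (0≤- (<⇒≤ x⁻¹<0)))
                             (solve 2 (λ x y → x :* y :+ x :* (con (+ 0) :- y) := con (+ 0))
                               refl x (x ⁻¹)) ⟩
    0#                  ∎))

  ÷-cong : ∀ {x x′ y y′} → x ≈ x′ → y ≈ y′ → x ÷ y ≈ x′ ÷ y′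
  ÷-cong x≈x′ y≈y′ = *-cong x≈x′ (⁻¹-cong y≈y′)

  -‿cong₂ : ∀ {x x′ y y′} → x ≈ x′ → y ≈ y′ → x - y ≈ x′ - y′
  -‿cong₂ x≈x′ y≈y′ = +-cong x≈x′ (-‿cong y≈y′)

  0≤fromℕ : ∀ n → 0# ≤ fromℕ n
  0≤fromℕ zero    = ≤-refl
  0≤fromℕ (suc n) = 0≤+ (<⇒≤ 0<1) (0≤fromℕ n)

  0<fromℕ-suc : ∀ n → 0# < fromℕ (suc n)
  0<fromℕ-suc n = 0<+ 0<1 (0≤fromℕ n)

  fromℕ-mono-≤ : ∀ {m n} → m ℕ.≤ n → fromℕ m ≤ fromℕ n
  fromℕ-mono-≤ {n = n} ℕ.z≤n = 0≤fromℕ n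
  fromℕ-mono-≤ {suc m} {suc n} (ℕ.s≤s m≤n) = +-monoʳ-≤ 1# (fromℕ-mono-≤ {m} {n} m≤n)

  fromℕ-cancel-< : ∀ {m n} → fromℕ m < fromℕ n → m ℕ.< n
  fromℕ-cancel-< {m} {n} m<n = ℕ.≰⇒> (λ n≤m → ≤⇒≯ (fromℕ-mono-≤ {n} {m} n≤m) m<n)

  fromℕ-mono-< : ∀ {m n} → m ℕ.< n → fromℕ m < fromℕ n
  fromℕ-mono-< {m} {n} m<n = begin-strict
    fromℕ m              ≈⟨ +-identityˡ _ ⟨
    0# + fromℕ m         <⟨ +-monoˡ-< (fromℕ m) 0<1 ⟩
    fromℕ (suc m)        ≤⟨ fromℕ-mono-≤ {suc m} {n} m<n ⟩
    fromℕ n              ∎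

-- Long jobs in each phase, and the arrangement with long jobs first.

tested : ∀ {n} → Fin (suc n) → Vec Kind n → ℕ
tested zero    v           = 0
tested (suc a) (short ∷ v) = tested a v
tested (suc a) (long  ∷ v) = suc (tested a v)

untested : ∀ {n} → Fin (suc n) → Vec Kind n → ℕ
untested zero    v       = #long v
untested (suc a) (_ ∷ v) = untested a v

tested≤ : ∀ {n} (a : Fin (suc n)) v → tested a v ℕ.≤ toℕ a
tested≤ zero    v           = ℕ.z≤n
tested≤ (suc a) (short ∷ v) = ℕ.m≤n⇒m≤1+n (tested≤ a v)
tested≤ (suc a) (long  ∷ v) = ℕ.s≤s (tested≤ a v)

untested≤ : ∀ {n} (a : Fin (suc n)) v → toℕ a ℕ.+ untested a v ℕ.≤ n
untested≤ zero    v       = count≤n long? v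
untested≤ (suc a) (_ ∷ v) = ℕ.s≤s (untested≤ a v)

tested+untested : ∀ {n} (a : Fin (suc n)) v → tested a v ℕ.+ untested a v ≡ #long v
tested+untested zero    v           = ≡.refl
tested+untested (suc a) (short ∷ v) = tested+untested a v
tested+untested (suc a) (long  ∷ v) = ≡.cong suc (tested+untested a v)

longFirst : ∀ n → ℕ → Vec Kind n
longFirst zero    m       = []
longFirst (suc n) zero    = short ∷ longFirst n zero
longFirst (suc n) (suc m) = long ∷ longFirst n m

-- Surplus long jobs are silently dropped; only pairs satisfying `Feasible` are meant.
worstCase : ∀ {n} → Fin (suc n) → ℕ → ℕ → Vec Kind n
worstCase {n}     zero    k       m = longFirst n m
worstCase {suc n} (suc a) zero    m = short ∷ worstCase a zero m
worstCase {suc n} (suc a) (suc k) m = long ∷ worstCase a k m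

#long-longFirst : ∀ n m → m ℕ.≤ n → #long (longFirst n m) ≡ m
#long-longFirst zero    zero    _           = ≡.refl
#long-longFirst (suc n) zero    _           = #long-longFirst n zero ℕ.z≤n
#long-longFirst (suc n) (suc m) (ℕ.s≤s m≤n) = ≡.cong suc (#long-longFirst n m m≤n)

tested-worstCase : ∀ {n} (a : Fin (suc n)) k m → k ℕ.≤ toℕ a → tested a (worstCase a k m) ≡ k
tested-worstCase         zero    zero    m _           = ≡.refl
tested-worstCase {suc n} (suc a) zero    m _           = tested-worstCase a zero m ℕ.z≤n
tested-worstCase {suc n} (suc a) (suc k) m (ℕ.s≤s k≤a) = ≡.cong suc (tested-worstCase a k m k≤a)

untested-worstCase : ∀ {n} (a : Fin (suc n)) k m → toℕ a ℕ.+ m ℕ.≤ n →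
                     untested a (worstCase a k m) ≡ m
untested-worstCase {n}     zero    k       m m≤n           = #long-longFirst n m m≤n
untested-worstCase {suc n} (suc a) zero    m (ℕ.s≤s a+m≤n) = untested-worstCase a zero m a+m≤n
untested-worstCase {suc n} (suc a) (suc k) m (ℕ.s≤s a+m≤n) = untested-worstCase a k m a+m≤n

record Feasible (n a k m : ℕ) : Set where
  constructor feasible
  field
    k≤a   : k ℕ.≤ a
    a+m≤n : a ℕ.+ m ℕ.≤ n

-- The constants are `fromℕ 1` and `fromℕ 2`, and the arguments are arbitrary numbers, so that
-- evaluating `valueᵉ` in a memory unfolds to `value` of the cells.
module Values {c ℓ₁ ℓ₂} (F : OrderedField c ℓ₁ ℓ₂) where

  open OrderedField F hiding (zero)

  excess : (X N A K M : Carrier) → Carrier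
  excess X N A K M =
    A * N - (A - K) * (A - K - fromℕ 1) ÷ fromℕ 2 + X * (M * (N - A - M))

  optimum : (P X N L : Carrier) → Carrier
  optimum P X N L = (P * (N * (N + fromℕ 1)) + X * (L * (L + fromℕ 1))) ÷ fromℕ 2

  value : (P X N A K M : Carrier) → Carrier
  value P X N A K M = excess X N A K M ÷ optimum P X N (K + M)

  -- Exchanging a tested long job for an untested one raises the excess by
  -- swapGain − (A − K).

  swapGain : (X N A M : Carrier) → Carrier
  swapGain X N A M = X * (N - A - M - M - fromℕ 1)

module GameProperties {c ℓ₁ ℓ₂} (F : OrderedField c ℓ₁ ℓ₂) (p x : OrderedField.Carrier F)
  (0<p : OrderedField._<_ F (OrderedField.0# F) p)
  (0<x : OrderedField._<_ F (OrderedField.0# F) x) where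

  open OrderedField F hiding (zero)
  open OrderedFieldProperties F
  open ≤-Reasoning
  open RingSolver
  open Game F p x
  open Values F
  open Max totalOrder using (⊔-lub; x≤x⊔y; x≤y⊔x)

  0≤x : 0# ≤ x
  0≤x = <⇒≤ 0<x

  -- Halves, triangular numbers and numbers of pairs.

  ½ : Carrier
  ½ = fromℕ 2 ⁻¹

  fromℕ-1 : fromℕ 1 ≈ 1#
  fromℕ-1 = +-identityʳ 1#

  2≉0 : ¬ (fromℕ 2 ≈ 0#)
  2≉0 2≈0 = <-irrefl (sym 2≈0) (0<fromℕ-suc 1)

  -- The solver sees `½` as a variable; that twice `½` is 1 enters the calculations only here.
  halves : ∀ y → (y + y) * ½ ≈ y
  halves y = begin-equality
    (y + y) * ½          ≈⟨ solve 2 (λ y h → (y :+ y) :* h :=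
                              y :* ((con (+ 1) :+ (con (+ 1) :+ con (+ 0))) :* h)) refl y ½ ⟩
    y * (fromℕ 2 * ½)    ≈⟨ *-congˡ (⁻¹-inverseʳ (fromℕ 2) 2≉0) ⟩
    y * 1#               ≈⟨ *-identityʳ y ⟩
    y                    ∎

  triangle pairs : Carrier → Carrier
  triangle y = y * (y + 1#) * ½
  pairs    y = y * (y - 1#) * ½

  triangleᵖ pairsᵖ : ∀ {n} → Polynomial n → Polynomial n → Polynomial n
  triangleᵖ h y = y :* (y :+ con (+ 1)) :* h
  pairsᵖ    h y = y :* (y :- con (+ 1)) :* h

  triangle-suc : ∀ y → triangle (1# + y) ≈ triangle y + (1# + y)
  triangle-suc y = begin-equality
    triangle (1# + y)                            ≈⟨ solve 2 (λ y h → let z = con (+ 1) :+ y in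
                                                      triangleᵖ h z := triangleᵖ h y :+ (z :+ z) :* h)
                                                      refl y ½ ⟩
    triangle y + ((1# + y) + (1# + y)) * ½       ≈⟨ +-congˡ (halves (1# + y)) ⟩
    triangle y + (1# + y)                        ∎

  -- A pair from a disjoint union lies in one part or the other, or is one of the y z mixed pairs.
  pairs-+ : ∀ y z → pairs (y + z) ≈ pairs y + y * z + pairs z
  pairs-+ y z = begin-equality
    pairs (y + z)                                ≈⟨ solve 3 (λ y z h → pairsᵖ h (y :+ z) :=
                                                      pairsᵖ h y :+ (y :* z :+ y :* z) :* h :+ pairsᵖ h z)
                                                      refl y z ½ ⟩
    pairs y + (y * z + y * z) * ½ + pairs z      ≈⟨ +-congʳ (+-congˡ (halves (y * z))) ⟩
    pairs y + y * z + pairs z                    ∎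

  pairs-suc : ∀ y → pairs (1# + y) ≈ y + pairs y
  pairs-suc y = begin-equality
    pairs (1# + y)                     ≈⟨ pairs-+ 1# y ⟩
    pairs 1# + 1# * y + pairs y        ≈⟨ solve 3 (λ y q h → pairsᵖ h (con (+ 1)) :+ con (+ 1) :* y :+ q := y :+ q)
                                            refl y (pairs y) ½ ⟩
    y + pairs y                        ∎

  -- Integrality matters: y (y - 1)/2 is negative strictly between 0 and 1. Hence the induction on
  -- `n`.
  0≤pairs-fromℕ : ∀ n → 0# ≤ pairs (fromℕ n)
  0≤pairs-fromℕ zero    = ≤-reflexive (solve 1 (λ h → con (+ 0) := pairsᵖ h (con (+ 0))) refl ½)
  0≤pairs-fromℕ (suc n) = begin
    0#                         ≤⟨ 0≤+ (0≤fromℕ n) (0≤pairs-fromℕ n) ⟩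
    fromℕ n + pairs (fromℕ n)  ≈⟨ pairs-suc (fromℕ n) ⟨
    pairs (fromℕ (suc n))      ∎

  -- The cost of the two phases.

  fromℕ-pronic : ∀ n → fromℕ (n ℕ.* (n ℕ.+ 1)) ≈ fromℕ n * (fromℕ n + fromℕ 1)
  fromℕ-pronic n = trans (fromℕ-* n (n ℕ.+ 1)) (*-congˡ (fromℕ-+ n 1))

  -- Final cost when Q untested jobs remain, M of them long and in front, and K long jobs are
  -- already postponed. The long ones add x (Q + K), x (Q + K - 1), and so on; the sum is arranged
  -- so that `triangle (K + M)`, the contribution of long jobs to OPT, splits off.
  costE : (A Q K M : Carrier) → Carrier
  costE A Q K M = A + x * (M * (Q - M)) + x * triangle (K + M)

  costEᵖ : ∀ {n} → (h x A Q K M : Polynomial n) → Polynomial n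
  costEᵖ h x A Q K M = A :+ x :* (M :* (Q :- M)) :+ x :* triangleᵖ h (K :+ M)

  run-E-[] : ∀ A k → A + x * fromℕ (k ℕ.* (k ℕ.+ 1)) ÷ fromℕ 2 ≈ costE A 0# (fromℕ k) 0#
  run-E-[] A k = begin-equality
    A + x * fromℕ (k ℕ.* (k ℕ.+ 1)) * ½             ≈⟨ +-congˡ (*-congʳ (*-congˡ (fromℕ-pronic k))) ⟩
    A + x * (fromℕ k * (fromℕ k + fromℕ 1)) * ½     ≈⟨ solve 4 (λ A x k h →
                                                         A :+ x :* (k :* (k :+ (con (+ 1) :+ con (+ 0)))) :* h
                                                           := costEᵖ h x A (con (+ 0)) k (con (+ 0)))
                                                         refl A x (fromℕ k) ½ ⟩
    costE A 0# (fromℕ k) 0#                         ∎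

  -- A leading short job lowers the counter by one for each of the M long jobs behind it, a loss of
  -- x M for the adversary. The loss vanishes when no long job follows, as in `longFirst`.
  costE-short : ∀ A Q K M → costE A Q K M + x * M ≈ costE A (1# + Q) K M
  costE-short A Q K M = solve 6 (λ A Q K M x h →
    costEᵖ h x A Q K M :+ x :* M := costEᵖ h x A (con (+ 1) :+ Q) K M) refl A Q K M x ½

  costE-long : ∀ A q k M → costE (A + fromℕ (suc q ℕ.+ k) * x) (fromℕ q) (fromℕ k) M
                           ≈ costE A (fromℕ (suc q)) (fromℕ k) (1# + M)
  costE-long A q k M = begin-equality
    costE (A + fromℕ (suc q ℕ.+ k) * x) (fromℕ q) (fromℕ k) M
      ≈⟨ +-congʳ (+-congʳ (+-congˡ (*-congʳ (+-congˡ (fromℕ-+ q k))))) ⟩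
    costE (A + (1# + (Q + K)) * x) Q K M
      ≈⟨ solve 6 (λ A Q K M x t →
           A :+ (con (+ 1) :+ (Q :+ K)) :* x :+ x :* (M :* (Q :- M)) :+ x :* t
           := A :+ x :* ((con (+ 1) :+ M) :* ((con (+ 1) :+ Q) :- (con (+ 1) :+ M)))
                :+ x :* (t :+ (con (+ 1) :+ (K :+ M))))
           refl A Q K M x (triangle (K + M)) ⟩
    A + x * ((1# + M) * ((1# + Q) - (1# + M))) + x * (triangle (K + M) + (1# + (K + M)))
      ≈⟨ +-congˡ (*-congˡ (triangle-suc (K + M))) ⟨
    A + x * ((1# + M) * ((1# + Q) - (1# + M))) + x * triangle (1# + (K + M))
      ≈⟨ +-congˡ (*-congˡ (solve 3 (λ K M h → triangleᵖ h (con (+ 1) :+ (K :+ M))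
           := triangleᵖ h (K :+ (con (+ 1) :+ M))) refl K M ½)) ⟩
    costE A (1# + Q) K (1# + M) ∎
    where Q = fromℕ q ; K = fromℕ k

  run-E≤ : ∀ {q} (v : Vec Kind q) A k →
           run (replicate q E) v A (q ℕ.+ k) ≤ costE A (fromℕ q) (fromℕ k) (fromℕ (#long v))
  run-E≤ []          A k = ≤-reflexive (run-E-[] A k)
  run-E≤ {suc q} (short ∷ v) A k = begin
    run (replicate q E) v A (q ℕ.+ k)
      ≤⟨ run-E≤ v A k ⟩
    costE A (fromℕ q) (fromℕ k) (fromℕ (#long v))
      ≤⟨ ≤-gap _ (0≤* 0≤x (0≤fromℕ (#long v))) (costE-short _ _ _ _) ⟩
    costE A (fromℕ (suc q)) (fromℕ k) (fromℕ (#long v)) ∎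
  run-E≤ {suc q} (long ∷ v) A k = begin
    run (replicate q E) v (A + fromℕ (suc q ℕ.+ k) * x) (q ℕ.+ k)
      ≤⟨ run-E≤ v _ k ⟩
    costE (A + fromℕ (suc q ℕ.+ k) * x) (fromℕ q) (fromℕ k) (fromℕ (#long v))
      ≈⟨ costE-long A q k (fromℕ (#long v)) ⟩
    costE A (fromℕ (suc q)) (fromℕ k) (fromℕ (suc (#long v))) ∎

  run-E-longFirst : ∀ q m A k → m ℕ.≤ q →
    run (replicate q E) (longFirst q m) A (q ℕ.+ k) ≈ costE A (fromℕ q) (fromℕ k) (fromℕ m)
  run-E-longFirst zero    zero    A k _           = run-E-[] A k
  run-E-longFirst (suc q) zero    A k _           = begin-equality
    run (replicate q E) (longFirst q 0) A (q ℕ.+ k)  ≈⟨ run-E-longFirst q 0 A k ℕ.z≤n ⟩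
    costE A (fromℕ q) (fromℕ k) 0#                   ≈⟨ +-identityʳ _ ⟨
    costE A (fromℕ q) (fromℕ k) 0# + 0#              ≈⟨ +-congˡ (zeroʳ x) ⟨
    costE A (fromℕ q) (fromℕ k) 0# + x * 0#          ≈⟨ costE-short _ _ _ _ ⟩
    costE A (fromℕ (suc q)) (fromℕ k) 0#             ∎
  run-E-longFirst (suc q) (suc m) A k (ℕ.s≤s m≤q) = begin-equality
    run (replicate q E) (longFirst q m) (A + fromℕ (suc q ℕ.+ k) * x) (q ℕ.+ k)
      ≈⟨ run-E-longFirst q m _ k m≤q ⟩
    costE (A + fromℕ (suc q ℕ.+ k) * x) (fromℕ q) (fromℕ k) (fromℕ m)
      ≈⟨ costE-long A q k (fromℕ m) ⟩
    costE A (fromℕ (suc q)) (fromℕ k) (fromℕ (suc m)) ∎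

  -- Here N jobs remain, the first B are tested, K of these are long and in front, and K₀ were
  -- postponed earlier. All B tests would cost N + K₀ each, but the counter falls after each of the
  -- B - K short jobs, which saves 0 + 1 + ... + (B - K - 1).
  costT : (A N B K₀ K M : Carrier) → Carrier
  costT A N B K₀ K M = costE (A + (B * (N + K₀) - pairs (B - K))) (N - B) (K₀ + K) M

  costTᵖ : ∀ {n} → (h x A N B K₀ K M : Polynomial n) → Polynomial n
  costTᵖ h x A N B K₀ K M =
    costEᵖ h x (A :+ (B :* (N :+ K₀) :- pairsᵖ h (B :- K))) (N :- B) (K₀ :+ K) M

  costT-[] : ∀ A N K₀ M → costT A N 0# K₀ 0# M ≈ costE A N K₀ M
  costT-[] A N K₀ M = solve 6 (λ A N K₀ M x h →
    costTᵖ h x A N (con (+ 0)) K₀ (con (+ 0)) M := costEᵖ h x A N K₀ M) refl A N K₀ M x ½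

  -- Testing a short job first makes the K later tests of long jobs cheaper by one each.
  costT-short : ∀ A N B K₀ K M →
    costT (A + (1# + (N + K₀))) N B K₀ K M + K ≈ costT A (1# + N) (1# + B) K₀ K M
  costT-short A N B K₀ K M = begin-equality
    costT (A + (1# + (N + K₀))) N B K₀ K M + K
      ≈⟨ solve 9 (λ A N B K₀ K M x s t →
           A :+ (con (+ 1) :+ (N :+ K₀)) :+ (B :* (N :+ K₀) :- s) :+ x :* (M :* (N :- B :- M)) :+ x :* t :+ K
           := A :+ ((con (+ 1) :+ B) :* (con (+ 1) :+ N :+ K₀) :- (B :- K :+ s))
                :+ x :* (M :* (con (+ 1) :+ N :- (con (+ 1) :+ B) :- M)) :+ x :* t)
           refl A N B K₀ K M x (pairs (B - K)) (triangle (K₀ + K + M)) ⟩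
    costE (A + ((1# + B) * (1# + N + K₀) - (B - K + pairs (B - K)))) (1# + N - (1# + B)) (K₀ + K) M
      ≈⟨ +-congʳ (+-congʳ (+-congˡ (+-congˡ (-‿cong (pairs-suc (B - K)))))) ⟨
    costE (A + ((1# + B) * (1# + N + K₀) - pairs (1# + (B - K)))) (1# + N - (1# + B)) (K₀ + K) M
      ≈⟨ +-congʳ (+-congʳ (+-congˡ (+-congˡ (-‿cong (solve 3 (λ B K h →
           pairsᵖ h (con (+ 1) :+ (B :- K)) := pairsᵖ h (con (+ 1) :+ B :- K)) refl B K ½))))) ⟩
    costT A (1# + N) (1# + B) K₀ K M ∎

  costT-long : ∀ A N B K₀ K M →
    costT (A + (1# + (N + K₀))) N B (1# + K₀) K M ≈ costT A (1# + N) (1# + B) K₀ (1# + K) M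
  costT-long A N B K₀ K M = solve 8 (λ A N B K₀ K M x h →
    costTᵖ h x (A :+ (con (+ 1) :+ (N :+ K₀))) N B (con (+ 1) :+ K₀) K M
    := costTᵖ h x A (con (+ 1) :+ N) (con (+ 1) :+ B) K₀ (con (+ 1) :+ K) M) refl A N B K₀ K M x ½

  costT-congA : ∀ {A A′ N B K₀ K M} → A ≈ A′ → costT A N B K₀ K M ≈ costT A′ N B K₀ K M
  costT-congA A≈A′ = +-congʳ (+-congʳ (+-congʳ A≈A′))

  -- The counter is a separate variable because a postponed job turns `suc n + k₀` into
  -- `n + suc k₀`, and these are equal only propositionally.
  run-T≤ : ∀ {n} (a : Fin (suc n)) (v : Vec Kind n) A k₀ {r} → r ≡ n ℕ.+ k₀ →
    run (twoPhase n a) v A r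
      ≤ costT A (fromℕ n) (fromℕ (toℕ a)) (fromℕ k₀) (fromℕ (tested a v)) (fromℕ (untested a v))
  run-T≤ {n} zero v A k₀ ≡.refl = begin
    run (replicate n E) v A (n ℕ.+ k₀)                      ≤⟨ run-E≤ v A k₀ ⟩
    costE A (fromℕ n) (fromℕ k₀) (fromℕ (#long v))          ≈⟨ costT-[] _ _ _ _ ⟨
    costT A (fromℕ n) 0# (fromℕ k₀) 0# (fromℕ (#long v))    ∎
  run-T≤ {suc n} (suc a) (short ∷ v) A k₀ ≡.refl = begin
    run (twoPhase n a) v (A + fromℕ (suc n ℕ.+ k₀)) (n ℕ.+ k₀)
      ≤⟨ run-T≤ a v _ k₀ ≡.refl ⟩
    costT (A + fromℕ (suc n ℕ.+ k₀)) (fromℕ n) (fromℕ (toℕ a)) (fromℕ k₀) (fromℕ k) (fromℕ m)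
      ≈⟨ costT-congA (+-congˡ (+-congˡ (fromℕ-+ n k₀))) ⟩
    costT (A + (1# + (fromℕ n + fromℕ k₀))) (fromℕ n) (fromℕ (toℕ a)) (fromℕ k₀) (fromℕ k) (fromℕ m)
      ≤⟨ ≤-gap _ (0≤fromℕ k) (costT-short _ _ _ _ _ _) ⟩
    costT A (fromℕ (suc n)) (fromℕ (suc (toℕ a))) (fromℕ k₀) (fromℕ k) (fromℕ m) ∎
    where k = tested a v ; m = untested a v
  run-T≤ {suc n} (suc a) (long ∷ v) A k₀ ≡.refl = begin
    run (twoPhase n a) v (A + fromℕ (suc n ℕ.+ k₀)) (suc n ℕ.+ k₀)
      ≤⟨ run-T≤ a v _ (suc k₀) (≡.sym (ℕ.+-suc n k₀)) ⟩
    costT (A + fromℕ (suc n ℕ.+ k₀)) (fromℕ n) (fromℕ (toℕ a)) (fromℕ (suc k₀)) (fromℕ k) (fromℕ m)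
      ≈⟨ costT-congA (+-congˡ (+-congˡ (fromℕ-+ n k₀))) ⟩
    costT (A + (1# + (fromℕ n + fromℕ k₀))) (fromℕ n) (fromℕ (toℕ a)) (fromℕ (suc k₀)) (fromℕ k) (fromℕ m)
      ≈⟨ costT-long _ _ _ _ _ _ ⟩
    costT A (fromℕ (suc n)) (fromℕ (suc (toℕ a))) (fromℕ k₀) (fromℕ (suc k)) (fromℕ m) ∎
    where k = tested a v ; m = untested a v

  run-T-worstCase : ∀ {n} (a : Fin (suc n)) k m A k₀ {r} → k ℕ.≤ toℕ a → toℕ a ℕ.+ m ℕ.≤ n →
    r ≡ n ℕ.+ k₀ →
    run (twoPhase n a) (worstCase a k m) A r
      ≈ costT A (fromℕ n) (fromℕ (toℕ a)) (fromℕ k₀) (fromℕ k) (fromℕ m)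
  run-T-worstCase {n} zero zero m A k₀ _ m≤n ≡.refl = begin-equality
    run (replicate n E) (longFirst n m) A (n ℕ.+ k₀)  ≈⟨ run-E-longFirst n m A k₀ m≤n ⟩
    costE A (fromℕ n) (fromℕ k₀) (fromℕ m)            ≈⟨ costT-[] _ _ _ _ ⟨
    costT A (fromℕ n) 0# (fromℕ k₀) 0# (fromℕ m)      ∎
  run-T-worstCase {suc n} (suc a) zero m A k₀ _ (ℕ.s≤s a+m≤n) ≡.refl = begin-equality
    run (twoPhase n a) (worstCase a 0 m) (A + fromℕ (suc n ℕ.+ k₀)) (n ℕ.+ k₀)
      ≈⟨ run-T-worstCase a 0 m _ k₀ ℕ.z≤n a+m≤n ≡.refl ⟩
    costT (A + fromℕ (suc n ℕ.+ k₀)) (fromℕ n) (fromℕ (toℕ a)) (fromℕ k₀) 0# (fromℕ m)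
      ≈⟨ costT-congA (+-congˡ (+-congˡ (fromℕ-+ n k₀))) ⟩
    costT (A + (1# + (fromℕ n + fromℕ k₀))) (fromℕ n) (fromℕ (toℕ a)) (fromℕ k₀) 0# (fromℕ m)
      ≈⟨ +-identityʳ _ ⟨
    costT (A + (1# + (fromℕ n + fromℕ k₀))) (fromℕ n) (fromℕ (toℕ a)) (fromℕ k₀) 0# (fromℕ m) + 0#
      ≈⟨ costT-short _ _ _ _ _ _ ⟩
    costT A (fromℕ (suc n)) (fromℕ (suc (toℕ a))) (fromℕ k₀) 0# (fromℕ m) ∎
  run-T-worstCase {suc n} (suc a) (suc k) m A k₀ (ℕ.s≤s k≤a) (ℕ.s≤s a+m≤n) ≡.refl = begin-equality
    run (twoPhase n a) (worstCase a k m) (A + fromℕ (suc n ℕ.+ k₀)) (suc n ℕ.+ k₀)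
      ≈⟨ run-T-worstCase a k m _ (suc k₀) k≤a a+m≤n (≡.sym (ℕ.+-suc n k₀)) ⟩
    costT (A + fromℕ (suc n ℕ.+ k₀)) (fromℕ n) (fromℕ (toℕ a)) (fromℕ (suc k₀)) (fromℕ k) (fromℕ m)
      ≈⟨ costT-congA (+-congˡ (+-congˡ (fromℕ-+ n k₀))) ⟩
    costT (A + (1# + (fromℕ n + fromℕ k₀))) (fromℕ n) (fromℕ (toℕ a)) (fromℕ (suc k₀)) (fromℕ k) (fromℕ m)
      ≈⟨ costT-long _ _ _ _ _ _ ⟩
    costT A (fromℕ (suc n)) (fromℕ (suc (toℕ a))) (fromℕ k₀) (fromℕ (suc k)) (fromℕ m) ∎

  -- From cost to ratio.

  pronicᵖ : ∀ {n} → Polynomial n → Polynomial n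
  pronicᵖ y = y :* (y :+ (con (+ 1) :+ con (+ 0)))

  optimumᵖ : ∀ {n} → (h p x N L : Polynomial n) → Polynomial n
  optimumᵖ h p x N L = (p :* pronicᵖ N :+ x :* pronicᵖ L) :* h

  excessᵖ : ∀ {n} → (h x N A K M : Polynomial n) → Polynomial n
  excessᵖ h x N A K M =
    A :* N :- (A :- K) :* (A :- K :- (con (+ 1) :+ con (+ 0))) :* h :+ x :* (M :* (N :- A :- M))

  startCost : ℕ → Carrier
  startCost n = p * fromℕ (n ℕ.* (n ℕ.+ 1)) ÷ fromℕ 2

  costT-startCost : ∀ n B K M → costT (startCost n) (fromℕ n) B 0# K M
                                ≈ optimum p x (fromℕ n) (K + M) + excess x (fromℕ n) B K M
  costT-startCost n B K M = begin-equality
    costT (startCost n) N B 0# K M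
      ≈⟨ costT-congA (*-congʳ (*-congˡ (fromℕ-pronic n))) ⟩
    costT (p * (N * (N + fromℕ 1)) ÷ fromℕ 2) N B 0# K M
      ≈⟨ solve 7 (λ N B K M p x h →
           costTᵖ h x (p :* pronicᵖ N :* h) N B (con (+ 0)) K M
           := optimumᵖ h p x N (K :+ M) :+ excessᵖ h x N B K M) refl N B K M p x ½ ⟩
    optimum p x N (K + M) + excess x N B K M ∎
    where N = fromℕ n

  pronic-cong : ∀ {y z} → y ≈ z → y * (y + fromℕ 1) ≈ z * (z + fromℕ 1)
  pronic-cong y≈z = *-cong y≈z (+-congʳ y≈z)

  OPT≈optimum : ∀ {n} (a : Fin (suc n)) v →
    OPT v ≈ optimum p x (fromℕ n) (fromℕ (tested a v) + fromℕ (untested a v))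
  OPT≈optimum {n} a v = *-congʳ (+-cong (*-congˡ (fromℕ-pronic n))
    (*-congˡ (trans (fromℕ-pronic (#long v)) (pronic-cong
      (trans (reflexive (≡.cong fromℕ (≡.sym (tested+untested a v))))
             (fromℕ-+ (tested a v) (untested a v)))))))

  -- Having at least one job makes the p-term positive even without long jobs; for n = 0 the
  -- denominator would be 0, where the inverse is unspecified.
  0<optimum : ∀ n k m → 1 ℕ.≤ n → 0# < optimum p x (fromℕ n) (fromℕ k + fromℕ m)
  0<optimum (suc n) k m _ = *-pos
    (0<+ (*-pos 0<p (*-pos 0<N (0<+ 0<N (0≤fromℕ 1))))
         (0≤* 0≤x (0≤* 0≤L (0≤+ 0≤L (0≤fromℕ 1)))))
    (0<⁻¹ (0<fromℕ-suc 1))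
    where
    0<N = 0<fromℕ-suc n
    0≤L = 0≤+ (0≤fromℕ k) (0≤fromℕ m)

  -- The ratio at `worstCase` minus 1. The constant is irrelevant to all comparisons, so the program
  -- works with `W`.
  W : (n a k m : ℕ) → Carrier
  W n a k m = value p x (fromℕ n) (fromℕ a) (fromℕ k) (fromℕ m)

  [y+z]÷y : ∀ {y} z → 0# < y → (y + z) ÷ y ≈ 1# + z ÷ y
  [y+z]÷y {y} z 0<y = trans (distribʳ (y ⁻¹) y z)
    (+-congʳ (⁻¹-inverseʳ y (λ y≈0 → <-irrefl (sym y≈0) 0<y)))

  module _ {n} (1≤n : 1 ℕ.≤ n) (a : Fin (suc n)) where

    ratio≤ : ∀ v → ratio (twoPhase n a) v ≤ 1# + W n (toℕ a) (tested a v) (untested a v)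
    ratio≤ v = begin
      ALG (twoPhase n a) v ÷ OPT v
        ≈⟨ *-congˡ (⁻¹-cong (OPT≈optimum a v)) ⟩
      ALG (twoPhase n a) v ÷ opt
        ≤⟨ *-monoʳ-≤ (<⇒≤ (0<⁻¹ 0<opt)) (run-T≤ a v _ 0 (≡.sym (ℕ.+-identityʳ n))) ⟩
      costT (startCost n) (fromℕ n) (fromℕ (toℕ a)) 0# K M ÷ opt
        ≈⟨ *-congʳ (costT-startCost n _ K M) ⟩
      (opt + excess x (fromℕ n) (fromℕ (toℕ a)) K M) ÷ opt
        ≈⟨ [y+z]÷y _ 0<opt ⟩
      1# + W n (toℕ a) (tested a v) (untested a v) ∎
      where
      K = fromℕ (tested a v)
      M = fromℕ (untested a v)
      opt = optimum p x (fromℕ n) (K + M)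
      0<opt = 0<optimum n (tested a v) (untested a v) 1≤n

    ratio-worstCase : ∀ {k m} → Feasible n (toℕ a) k m →
      ratio (twoPhase n a) (worstCase a k m) ≈ 1# + W n (toℕ a) k m
    ratio-worstCase {k} {m} (feasible k≤a a+m≤n) = begin-equality
      ALG (twoPhase n a) v ÷ OPT v
        ≈⟨ ÷-cong (run-T-worstCase a k m _ 0 k≤a a+m≤n (≡.sym (ℕ.+-identityʳ n))) OPT≈opt ⟩
      costT (startCost n) (fromℕ n) (fromℕ (toℕ a)) 0# (fromℕ k) (fromℕ m) ÷ opt
        ≈⟨ *-congʳ (costT-startCost n _ (fromℕ k) (fromℕ m)) ⟩
      (opt + excess x (fromℕ n) (fromℕ (toℕ a)) (fromℕ k) (fromℕ m)) ÷ opt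
        ≈⟨ [y+z]÷y _ (0<optimum n k m 1≤n) ⟩
      1# + W n (toℕ a) k m ∎
      where
      v = worstCase a k m
      opt = optimum p x (fromℕ n) (fromℕ k + fromℕ m)
      OPT≈opt : OPT v ≈ opt
      OPT≈opt = ≡.subst₂ (λ k m → OPT v ≈ optimum p x (fromℕ n) (fromℕ k + fromℕ m))
        (tested-worstCase a k m k≤a) (untested-worstCase a k m a+m≤n) (OPT≈optimum a v)

  -- Best replies and equilibria.

  maximum-lub : ∀ n {f : Vec Kind n → Carrier} {y} → (∀ v → f v ≤ y) → maximum n f ≤ y
  maximum-lub zero    f≤y = f≤y []
  maximum-lub (suc n) f≤y = ⊔-lub (maximum-lub n λ v → f≤y (short ∷ v))
                                  (maximum-lub n λ v → f≤y (long  ∷ v))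

  ≤-maximum : ∀ {n} {f : Vec Kind n → Carrier} v → f v ≤ maximum n f
  ≤-maximum []          = ≤-refl
  ≤-maximum (short ∷ v) = ≤-trans (≤-maximum v) (x≤x⊔y _ _)
  ≤-maximum (long  ∷ v) = ≤-trans (≤-maximum v) (x≤y⊔x _ _)

  BestReply : (n a k m : ℕ) → Set (ℓ₁ ⊔ ℓ₂)
  BestReply n a k m = ∀ {k′ m′} → Feasible n a k′ m′ → W n a k′ m′ ≤ W n a k m

  -- Against a rival a′ one reply worth at least `W n (toℕ a) k m` is enough, since it bounds the
  -- worst ratio of a′ from below; the best reply to a′ need not be remembered.
  equilibrium : ∀ {n} → 1 ℕ.≤ n → (a : Fin (suc n)) → ∀ {k m} →
    Feasible n (toℕ a) k m → BestReply n (toℕ a) k m →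
    (∀ a′ → ∃₂ λ k′ m′ → Feasible n (toℕ a′) k′ m′ × W n (toℕ a) k m ≤ W n (toℕ a′) k′ m′) →
    Equilibrium n a (worstCase a k m)
  equilibrium {n} 1≤n a {k} {m} feas best better =
    optimal , λ v → ≤-trans (bound v) (≤-reflexive (sym (ratio-worstCase 1≤n a feas)))
    where
    bound : ∀ v → ratio (twoPhase n a) v ≤ 1# + W n (toℕ a) k m
    bound v = ≤-trans (ratio≤ 1≤n a v)
      (+-monoʳ-≤ 1# (best (feasible (tested≤ a v) (untested≤ a v))))
    optimal : OptimalAlgorithm n a
    optimal a′ with k′ , m′ , feas′ , W≤W′ ← better a′ = begin
      worstRatio (twoPhase n a)                      ≤⟨ maximum-lub n bound ⟩
      1# + W n (toℕ a) k m                           ≤⟨ +-monoʳ-≤ 1# W≤W′ ⟩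
      1# + W n (toℕ a′) k′ m′                        ≈⟨ ratio-worstCase 1≤n a′ feas′ ⟨
      ratio (twoPhase n a′) (worstCase a′ k′ m′)     ≤⟨ ≤-maximum {n} (worstCase a′ k′ m′) ⟩
      worstRatio (twoPhase n a′)                     ∎

  -- Neither exchange of a tested with an untested long job raises the excess.

  record Balanced (n a k m : ℕ) : Set (ℓ₁ ⊔ ℓ₂) where
    field
      untested≮tested : 1 ℕ.≤ k →
        swapGain x (fromℕ n) (fromℕ a) (fromℕ m) ≤ fromℕ a - fromℕ k
      tested≮untested : 1 ℕ.≤ m → k ℕ.< a →
        fromℕ a - fromℕ k - fromℕ 1 ≤ swapGain x (fromℕ n) (fromℕ a) (fromℕ m) + x + x

  open Balanced

  -- Denotes `1# + 0#`, to which `fromℕ 1` unfolds; `con (+ 1)` denotes `1#`.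
  :1 : ∀ {n} → Polynomial n
  :1 = con (+ 1) :+ con (+ 0)

  swapGainᵖ : ∀ {n} → (x N A M : Polynomial n) → Polynomial n
  swapGainᵖ x N A M = x :* (N :- A :- M :- M :- :1)

  -- Concavity of the excess along a line k + m = ℓ.

  module _ (N A : Carrier) where

    excess≈ : ∀ K M {J} → J ≈ A - K → excess x N A K M ≈ A * N - pairs J + x * (M * (N - A - M))
    excess≈ K M {J} J≈ = begin-equality
      excess x N A K M                              ≈⟨ solve 6 (λ N A K M x h → excessᵖ h x N A K M :=
                                                         A :* N :- pairsᵖ h (A :- K) :+ x :* (M :* (N :- A :- M)))
                                                         refl N A K M x ½ ⟩
      A * N - pairs (A - K) + x * (M * (N - A - M)) ≈⟨ +-congʳ (+-congˡ (-‿cong (*-congʳ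
                                                         (*-cong J≈ (+-congʳ J≈))))) ⟨
      A * N - pairs J + x * (M * (N - A - M))       ∎

    -- Concavity as an exact formula: moving D long jobs to the untested phase loses D times the
    -- slack of a single exchange, plus second-order terms amounting to D (D - 1)(1/2 + x). With D =
    -- 1 + G the product D (D - 1) is D G, visibly nonnegative for a natural G.
    excess-toUntested : ∀ K M G → let D = 1# + G in
      excess x N A K (D + M) + (D * (A - (K + D) - swapGain x N A M) + pairs D + x * (D * G))
        ≈ excess x N A (K + D) M
    excess-toUntested K M G = begin-equality
      excess x N A K (D + M) + gap
        ≈⟨ +-congʳ (excess≈ K (D + M) (solve 3 (λ A K D → A :- (K :+ D) :+ D := A :- K) refl A K D)) ⟩
      A * N - pairs (J + D) + x * ((D + M) * (N - A - (D + M))) + gap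
        ≈⟨ +-congʳ (+-congʳ (+-congˡ (-‿cong (pairs-+ J D)))) ⟩
      A * N - (pairs J + J * D + pairs D) + x * ((D + M) * (N - A - (D + M))) + gap
        ≈⟨ solve 8 (λ N A M G x J s u → let D = con (+ 1) :+ G in
             A :* N :- (s :+ J :* D :+ u) :+ x :* ((D :+ M) :* (N :- A :- (D :+ M)))
               :+ (D :* (J :- swapGainᵖ x N A M) :+ u :+ x :* (D :* G))
             := A :* N :- s :+ x :* (M :* (N :- A :- M)))
             refl N A M G x J (pairs J) (pairs D) ⟩
      A * N - pairs J + x * (M * (N - A - M))
        ≈⟨ excess≈ (K + D) M refl ⟨
      excess x N A (K + D) M ∎
      where
      D   = 1# + G
      J   = A - (K + D)
      gap = D * (J - swapGain x N A M) + pairs D + x * (D * G)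

    excess-toTested : ∀ K M G → let D = 1# + G in
      excess x N A (K + D) M
        + (D * (swapGain x N A (D + M) + x + x - (A - K - fromℕ 1)) + (D * G - pairs D) + x * (D * G))
        ≈ excess x N A K (D + M)
    excess-toTested K M G = begin-equality
      excess x N A (K + D) M + gap
        ≈⟨ +-congʳ (excess≈ (K + D) M refl) ⟩
      A * N - pairs J + x * (M * (N - A - M)) + gap
        ≈⟨ solve 8 (λ N A K M G x s u → let D = con (+ 1) :+ G; J = A :- (K :+ D) in
             A :* N :- s :+ x :* (M :* (N :- A :- M))
               :+ (D :* (swapGainᵖ x N A (D :+ M) :+ x :+ x :- (A :- K :- :1))
                   :+ (D :* G :- u) :+ x :* (D :* G))
             := A :* N :- (s :+ J :* D :+ u) :+ x :* ((D :+ M) :* (N :- A :- (D :+ M))))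
             refl N A K M G x (pairs J) (pairs D) ⟩
      A * N - (pairs J + J * D + pairs D) + x * ((D + M) * (N - A - (D + M)))
        ≈⟨ +-congʳ (+-congˡ (-‿cong (pairs-+ J D))) ⟨
      A * N - pairs (J + D) + x * ((D + M) * (N - A - (D + M)))
        ≈⟨ excess≈ K (D + M) (solve 3 (λ A K D → A :- (K :+ D) :+ D := A :- K) refl A K D) ⟨
      excess x N A K (D + M) ∎
      where
      D   = 1# + G
      J   = A - (K + D)
      gap = D * (swapGain x N A (D + M) + x + x - (A - K - fromℕ 1)) + (D * G - pairs D) + x * (D * G)

  -- D (D - 1) is twice `pairs D`, so the difference is `pairs D` again.
  0≤rectangle-pairs : ∀ e → 0# ≤ fromℕ (suc e) * fromℕ e - pairs (fromℕ (suc e))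
  0≤rectangle-pairs e = begin
    0#                      ≤⟨ 0≤pairs-fromℕ (suc e) ⟩
    pairs D                 ≈⟨ solve 2 (λ E h → let D = con (+ 1) :+ E in pairsᵖ h D :=
                                 (D :* E :+ D :* E) :* h :- pairsᵖ h D) refl E′ ½ ⟩
    (D * E′ + D * E′) * ½ - pairs D  ≈⟨ +-congʳ (halves (D * E′)) ⟩
    D * E′ - pairs D        ∎
    where
    E′ = fromℕ e
    D  = fromℕ (suc e)

  excess-cong : ∀ {N A K K′ M M′} → K ≈ K′ → M ≈ M′ → excess x N A K M ≈ excess x N A K′ M′
  excess-cong K≈ M≈ = +-cong
    (+-congˡ (-‿cong (*-congʳ (*-cong (+-congˡ (-‿cong K≈)) (+-congʳ (+-congˡ (-‿cong K≈)))))))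
    (*-congˡ (*-cong M≈ (+-congˡ (-‿cong M≈))))

  -- Another pair on the line differs by moving d long jobs one way or the other. For d > 0 the gap
  -- formula for that direction applies, and its first-order term is nonnegative by the matching
  -- field of `Balanced`.
  excess-balanced : ∀ {n a k m k′ m′} → Balanced n a k m → k ℕ.≤ a → k′ ℕ.≤ a → k′ ℕ.+ m′ ≡ k ℕ.+ m →
    excess x (fromℕ n) (fromℕ a) (fromℕ k′) (fromℕ m′) ≤ excess x (fromℕ n) (fromℕ a) (fromℕ k) (fromℕ m)
  excess-balanced {n} {a} {k} {m} {k′} {m′} bal k≤a k′≤a k′+m′≡k+m with ℕ.≤-total k′ k
  ... | inj₁ k′≤k with ℕ.m≤n⇒∃[o]m+o≡n k′≤k
  ...   | d , ≡.refl with ℕ.+-cancelˡ-≡ k′ m′ (d ℕ.+ m) (≡.trans k′+m′≡k+m (ℕ.+-assoc k′ d m))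
  excess-balanced {n} {a} {_} {m} {k′} bal k≤a k′≤a _ | inj₁ _ | zero , ≡.refl | ≡.refl =
    ≤-reflexive (excess-cong (reflexive (≡.cong fromℕ (≡.sym (ℕ.+-identityʳ k′)))) refl)
  excess-balanced {n} {a} {_} {m} {k′} bal k≤a k′≤a _ | inj₁ _ | suc e , ≡.refl | ≡.refl = begin
    excess x N A (fromℕ k′) (fromℕ (suc e ℕ.+ m))
      ≈⟨ excess-cong refl (fromℕ-+ (suc e) m) ⟩
    excess x N A (fromℕ k′) (D + fromℕ m)
      ≤⟨ ≤-gap _ (0≤+ (0≤+ (0≤* (0≤fromℕ (suc e)) (0≤- no-swap)) (0≤pairs-fromℕ (suc e)))
                      (0≤* 0≤x (0≤* (0≤fromℕ (suc e)) (0≤fromℕ e))))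
           (excess-toUntested N A (fromℕ k′) (fromℕ m) (fromℕ e)) ⟩
    excess x N A (fromℕ k′ + D) (fromℕ m)
      ≈⟨ excess-cong (fromℕ-+ k′ (suc e)) refl ⟨
    excess x N A (fromℕ (k′ ℕ.+ suc e)) (fromℕ m) ∎
    where
    N = fromℕ n ; A = fromℕ a ; D = fromℕ (suc e)
    no-swap : swapGain x N A (fromℕ m) ≤ A - (fromℕ k′ + D)
    no-swap = ≤-trans (untested≮tested bal (ℕ.≤-trans (ℕ.s≤s ℕ.z≤n) (ℕ.m≤n+m (suc e) k′)))
      (≤-reflexive (+-congˡ (-‿cong (fromℕ-+ k′ (suc e)))))
  excess-balanced {n} {a} {k} {m} {k′} {m′} bal k≤a k′≤a k′+m′≡k+m | inj₂ k≤k′ with ℕ.m≤n⇒∃[o]m+o≡n k≤k′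
  ... | d , ≡.refl with ℕ.+-cancelˡ-≡ k (d ℕ.+ m′) m (≡.trans (≡.sym (ℕ.+-assoc k d m′)) k′+m′≡k+m)
  excess-balanced {n} {a} {k} {_} {_} {m′} bal k≤a k′≤a _ | inj₂ _ | zero , ≡.refl | ≡.refl =
    ≤-reflexive (excess-cong (reflexive (≡.cong fromℕ (ℕ.+-identityʳ k))) refl)
  excess-balanced {n} {a} {k} {_} {_} {m′} bal k≤a k′≤a _ | inj₂ _ | suc e , ≡.refl | ≡.refl = begin
    excess x N A (fromℕ (k ℕ.+ suc e)) (fromℕ m′)
      ≈⟨ excess-cong (fromℕ-+ k (suc e)) refl ⟩
    excess x N A (fromℕ k + D) (fromℕ m′)
      ≤⟨ ≤-gap _ (0≤+ (0≤+ (0≤* (0≤fromℕ (suc e)) (0≤- no-swap)) (0≤rectangle-pairs e))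
                      (0≤* 0≤x (0≤* (0≤fromℕ (suc e)) (0≤fromℕ e))))
           (excess-toTested N A (fromℕ k) (fromℕ m′) (fromℕ e)) ⟩
    excess x N A (fromℕ k) (D + fromℕ m′)
      ≈⟨ excess-cong refl (fromℕ-+ (suc e) m′) ⟨
    excess x N A (fromℕ k) (fromℕ (suc e ℕ.+ m′)) ∎
    where
    N = fromℕ n ; A = fromℕ a ; D = fromℕ (suc e)
    swapGain-cong : ∀ {M M′} → M ≈ M′ → swapGain x N A M ≈ swapGain x N A M′
    swapGain-cong M≈ = *-congˡ (+-congʳ (-‿cong₂ (-‿cong₂ refl M≈) M≈))
    no-swap : A - fromℕ k - fromℕ 1 ≤ swapGain x N A (D + fromℕ m′) + x + x
    no-swap = ≤-trans (tested≮untested bal (ℕ.s≤s ℕ.z≤n) (ℕ.<-≤-trans (ℕ.m<m+n k (ℕ.s≤s ℕ.z≤n)) k′≤a))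
      (≤-reflexive (+-congʳ (+-congʳ (swapGain-cong (fromℕ-+ (suc e) m′)))))

  W-balanced : ∀ {n a k m k′ m′} → 1 ℕ.≤ n → Balanced n a k m →
    Feasible n a k m → Feasible n a k′ m′ → k′ ℕ.+ m′ ≡ k ℕ.+ m → W n a k′ m′ ≤ W n a k m
  W-balanced {n} {a} {k} {m} {k′} {m′} 1≤n bal (feasible k≤a _) (feasible k′≤a _) k′+m′≡k+m = begin
    excess x N A (fromℕ k′) (fromℕ m′) ÷ optimum p x N (fromℕ k′ + fromℕ m′)
      ≤⟨ *-monoʳ-≤ (<⇒≤ (0<⁻¹ (0<optimum n k′ m′ 1≤n))) (excess-balanced bal k≤a k′≤a k′+m′≡k+m) ⟩
    excess x N A (fromℕ k) (fromℕ m) ÷ optimum p x N (fromℕ k′ + fromℕ m′)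
      ≈⟨ *-congˡ (⁻¹-cong (*-congʳ (+-congˡ (*-congˡ (pronic-cong ℓ′≈ℓ))))) ⟩
    excess x N A (fromℕ k) (fromℕ m) ÷ optimum p x N (fromℕ k + fromℕ m) ∎
    where
    N = fromℕ n ; A = fromℕ a
    ℓ′≈ℓ : fromℕ k′ + fromℕ m′ ≈ fromℕ k + fromℕ m
    ℓ′≈ℓ = trans (sym (fromℕ-+ k′ m′)) (trans (reflexive (≡.cong fromℕ k′+m′≡k+m)) (fromℕ-+ k m))

  -- The pairs (k, m + 1) and (k + 1, m) are exchange neighbours, and their excesses differ by
  -- `swapGain` at m minus a - (k + 1). This is the condition that (k, m + 1) is strictly better.
  Prefer-untested : (n a k m : ℕ) → Set ℓ₂
  Prefer-untested n a k m =
    fromℕ a - fromℕ k - fromℕ 1 < swapGain x (fromℕ n) (fromℕ a) (fromℕ m)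

  -- Growing a balanced pair by one long job.

  balanced-start : ∀ n a → Balanced n a 0 0
  balanced-start n a = record { untested≮tested = λ () ; tested≮untested = λ () }

  A-[1+K] : ∀ A K → A - K - fromℕ 1 ≈ A - (1# + K)
  A-[1+K] A K = solve 2 (λ A K → A :- K :- :1 := A :- (con (+ 1) :+ K)) refl A K

  swapGain-suc : ∀ N A M → swapGain x N A (1# + M) + x + x ≈ swapGain x N A M
  swapGain-suc N A M = solve 4 (λ N A M x →
    swapGainᵖ x N A (con (+ 1) :+ M) :+ x :+ x := swapGainᵖ x N A M) refl N A M x

  -- The failed preference is the first inequality for k + 1; the second one only gets weaker as k
  -- grows.
  balanced-tested : ∀ {n a k m} → Balanced n a k m → ¬ Prefer-untested n a k m → Balanced n a (suc k) m
  balanced-tested {n} {a} {k} {m} bal ¬pref = record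
    { untested≮tested = λ _ → begin
        swapGain x (fromℕ n) A (fromℕ m)   ≤⟨ ≮⇒≥ ¬pref ⟩
        A - fromℕ k - fromℕ 1              ≈⟨ A-[1+K] A (fromℕ k) ⟩
        A - fromℕ (suc k)                  ∎
    ; tested≮untested = λ 1≤m k<a → begin
        A - fromℕ (suc k) - fromℕ 1
          ≤⟨ ≤-gap 1# (<⇒≤ 0<1) (solve 2 (λ A K → A :- (con (+ 1) :+ K) :- :1 :+ con (+ 1) := A :- K :- :1)
               refl A (fromℕ k)) ⟩
        A - fromℕ k - fromℕ 1
          ≤⟨ tested≮untested bal 1≤m (ℕ.<-trans (ℕ.n<1+n k) k<a) ⟩
        swapGain x (fromℕ n) A (fromℕ m) + x + x ∎
    }
    where A = fromℕ a

  -- The roles are reversed: `swapGain` drops by 2x as m grows, so the first inequality survives,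
  -- and the second is the preference itself, or vacuous when k = a.
  balanced-untested : ∀ {n a k m} → Balanced n a k m → (k ℕ.< a → Prefer-untested n a k m) →
                      Balanced n a k (suc m)
  balanced-untested {n} {a} {k} {m} bal pref = record
    { untested≮tested = λ 1≤k → begin
        swapGain x N A (fromℕ (suc m))
          ≤⟨ ≤-gap (x + x) (0≤+ 0≤x 0≤x) (trans (sym (+-assoc _ _ _)) (swapGain-suc N A (fromℕ m))) ⟩
        swapGain x N A (fromℕ m)
          ≤⟨ untested≮tested bal 1≤k ⟩
        A - fromℕ k ∎
    ; tested≮untested = λ _ k<a → begin
        A - fromℕ k - fromℕ 1
          ≤⟨ <⇒≤ (pref k<a) ⟩
        swapGain x N A (fromℕ m)
          ≈⟨ swapGain-suc N A (fromℕ m) ⟨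
        swapGain x N A (fromℕ (suc m)) + x + x ∎
    }
    where N = fromℕ n ; A = fromℕ a

  -- If a + m = n, then `swapGain` is -x (m + 1), below the nonnegative a - k - 1, so the preference
  -- fails.
  prefer⇒room : ∀ {n a k m} → Feasible n a k m → k ℕ.< a → Prefer-untested n a k m → a ℕ.+ m ℕ.< n
  prefer⇒room {n} {a} {k} {m} (feasible _ a+m≤n) k<a pref with ℕ.m≤n⇒m<n∨m≡n a+m≤n
  ... | inj₁ a+m<n  = a+m<n
  ... | inj₂ ≡.refl = contradiction pref (≤⇒≯ (≤-gap
    (x * (M + fromℕ 1) + (A - K - fromℕ 1))
    (0≤+ (0≤* 0≤x (0≤+ (0≤fromℕ m) (0≤fromℕ 1)))
         (≤-trans (0≤- (fromℕ-mono-≤ {suc k} {a} k<a)) (≤-reflexive (sym (A-[1+K] A K)))))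
    (begin-equality
      swapGain x (fromℕ (a ℕ.+ m)) A M + (x * (M + fromℕ 1) + (A - K - fromℕ 1))
        ≈⟨ +-congʳ (*-congˡ (+-congʳ (+-congʳ (+-congʳ (+-congʳ (fromℕ-+ a m)))))) ⟩
      swapGain x (A + M) A M + (x * (M + fromℕ 1) + (A - K - fromℕ 1))
        ≈⟨ solve 4 (λ A K M x → swapGainᵖ x (A :+ M) A M :+ (x :* (M :+ :1) :+ (A :- K :- :1))
             := A :- K :- :1) refl A K M x ⟩
      A - K - fromℕ 1 ∎)))
    where A = fromℕ a ; K = fromℕ k ; M = fromℕ m

  feasible-untested : ∀ {n a k m} → Feasible n a k m → k ℕ.+ m ℕ.< n →
    (k ℕ.< a → Prefer-untested n a k m) → Feasible n a k (suc m)
  feasible-untested {n} {a} {k} {m} feas@(feasible k≤a _) k+m<n pref =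
    feasible k≤a (≡.subst (ℕ._≤ n) (≡.sym (ℕ.+-suc a m)) room)
    where
    room : a ℕ.+ m ℕ.< n
    room with ℕ.m≤n⇒m<n∨m≡n k≤a
    ... | inj₁ k<a    = prefer⇒room feas k<a (pref k<a)
    ... | inj₂ ≡.refl = k+m<n

-- Static time bounds and their growth.

bound : Program → ℕ
bound skip        = 0
bound (put i e)   = 1 ℕ.+ costᵉ e
bound (putAt d e) = 1 ℕ.+ costᵉ d ℕ.+ costᵉ e
bound (emit a)    = 1
bound (P ⨾ Q)     = bound P ℕ.+ bound Q
bound (if g P Q)  = costᵍ g ℕ.+ (bound P ℕ.⊔ bound Q)
-- A placeholder: `wp-rule` is the only place that relies on `bound`, and there the precondition of
-- a loop is false.
bound (while g P) = 0

-- The guard is evaluated once more than the body, namely d + 1 times.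
whileBound : Guard → ℕ → ℕ → ℕ
whileBound g b d = costᵍ g ℕ.+ d ℕ.* (costᵍ g ℕ.+ b)

record GrowsAs (k : ℕ) (f : ℕ → ℕ) : Set where
  constructor growsAs
  field
    factor : ℕ
    f≤     : ∀ n → 1 ℕ.≤ n → f n ℕ.≤ factor ℕ.* n ℕ.^ k

constant : ∀ k b → GrowsAs k (λ _ → b)
constant k b = growsAs b λ { (suc n) _ → ℕ.m≤m*n b (suc n ℕ.^ k) {{ℕ.m^n≢0 (suc n) k}} }

infixl 6 _⊞_

_⊞_ : ∀ {k f g} → GrowsAs k f → GrowsAs k g → GrowsAs k (λ n → f n ℕ.+ g n)
_⊞_ {k} (growsAs C f≤) (growsAs D g≤) = growsAs (C ℕ.+ D) λ n 1≤n →
  ℕ.≤-trans (ℕ.+-mono-≤ (f≤ n 1≤n) (g≤ n 1≤n)) (ℕ.≤-reflexive (≡.sym (ℕ.*-distribʳ-+ (n ℕ.^ k) C D)))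

times-n : ∀ {k f} → GrowsAs k f → GrowsAs (suc k) (λ n → n ℕ.* f n)
times-n {k} (growsAs C f≤) = growsAs C λ n 1≤n →
  ℕ.≤-trans (ℕ.*-monoʳ-≤ n (f≤ n 1≤n)) (ℕ.≤-reflexive (swap n C (n ℕ.^ k)))
  where
  swap : ∀ n C m → n ℕ.* (C ℕ.* m) ≡ C ℕ.* (n ℕ.* m)
  swap = solve-∀

raise : ∀ {k f} → GrowsAs k f → GrowsAs (suc k) f
raise {k} (growsAs C f≤) = growsAs C λ { (suc n) 1≤n →
  ℕ.≤-trans (f≤ (suc n) 1≤n) (ℕ.*-monoʳ-≤ C (ℕ.m≤n*m (suc n ℕ.^ k) (suc n))) }

whileBound-growth : ∀ {k f} g → GrowsAs k f → GrowsAs (suc k) (λ n → whileBound g (f n) n)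
whileBound-growth {k} g f-growth = constant (suc k) (costᵍ g) ⊞ times-n (constant k (costᵍ g) ⊞ f-growth)

-- Weakest preconditions and total correctness with time bounds.

module ProgramLogic {c ℓ₁ ℓ₂} (F : OrderedField c ℓ₁ ℓ₂) where

  open OrderedField F hiding (zero; refl; sym; trans)
  open OrderedFieldProperties F using (_<?_)
  open Machine F

  Predicate : Set _
  Predicate = State → Set (c ⊔ ℓ₁ ⊔ ℓ₂)

  -- Loops are left to while-rule, so wp is false on them.

  wp : Program → Predicate → Predicate
  wp skip        R s = R s
  wp (put i e)   R s = R ⟪ memory s [ i ≔ ⟦ e ⟧ (memory s) ] , output s ⟫
  wp (putAt d e) R s = R ⟪ memory s [ address (⟦ d ⟧ (memory s)) ≔ ⟦ e ⟧ (memory s) ] , output s ⟫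
  wp (emit a)    R s = R ⟪ memory s , output s ∷ʳ a ⟫
  wp (P ⨾ Q)     R s = wp P (wp Q R) s
  wp (if g P Q)  R s = (Holds g (memory s) → wp P R s) × (¬ Holds g (memory s) → wp Q R s)
  wp (while g P) R s = Lift _ ⊥

  Ensures : Program → State → Predicate → ℕ → Set _
  Ensures P s R b = ∃[ s′ ] ∃[ t ] (P ∶ s ⇓ s′ time t) × (t ℕ.≤ b) × R s′

  weaken : ∀ {P s R b b′} → b ℕ.≤ b′ → Ensures P s R b → Ensures P s R b′
  weaken b≤b′ (s′ , t , P⇓ , t≤b , r) = s′ , t , P⇓ , ℕ.≤-trans t≤b b≤b′ , r

  infixl 5 _⇒_

  _⇒_ : ∀ {P s R S b} → Ensures P s R b → (∀ {s′} → R s′ → S s′) → Ensures P s S b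
  (s′ , t , P⇓ , t≤b , r) ⇒ R⇒S = s′ , t , P⇓ , t≤b , R⇒S r

  infixr 6 _then_

  _then_ : ∀ {P Q s R S b b′} → Ensures P s R b → (∀ {s′} → R s′ → Ensures Q s′ S b′) →
           Ensures (P ⨾ Q) s S (b ℕ.+ b′)
  (s′ , t , P⇓ , t≤b , r) then rest with rest r
  ... | s″ , t′ , Q⇓ , t′≤b′ , r′ = s″ , t ℕ.+ t′ , P⇓ ⨾ Q⇓ , ℕ.+-mono-≤ t≤b t′≤b′ , r′

  decide : ∀ g μ → Holds g μ ⊎ ¬ Holds g μ
  decide (d ⊲ e) μ with ⟦ d ⟧ μ <? ⟦ e ⟧ μ
  ... | yes h = inj₁ h
  ... | no ¬h = inj₂ ¬h

  wp-rule : ∀ P {R s} → wp P R s → Ensures P s R (bound P)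
  wp-rule skip        r = _ , _ , skip , ℕ.≤-refl , r
  wp-rule (put i e)   r = _ , _ , put , ℕ.≤-refl , r
  wp-rule (putAt d e) r = _ , _ , putAt , ℕ.≤-refl , r
  wp-rule (emit a)    r = _ , _ , emit , ℕ.≤-refl , r
  wp-rule (P ⨾ Q)     r = wp-rule P r then wp-rule Q
  wp-rule (if g P Q) {s = s} (r , r′) with decide g (memory s)
  ... | inj₁ h with wp-rule P (r h)
  ...   | s′ , t , P⇓ , t≤b , q =
    s′ , _ , if-true h P⇓ , ℕ.+-monoʳ-≤ (costᵍ g) (ℕ.≤-trans t≤b (ℕ.m≤m⊔n _ _)) , q
  wp-rule (if g P Q) {s = s} (r , r′) | inj₂ ¬h with wp-rule Q (r′ ¬h)
  ...   | s′ , t , Q⇓ , t≤b , q =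
    s′ , _ , if-false ¬h Q⇓ , ℕ.+-monoʳ-≤ (costᵍ g) (ℕ.≤-trans t≤b (ℕ.m≤n⊔m _ _)) , q
  wp-rule (while g P) ()

  -- The index of Inv is the number of iterations still to come.

  while-rule : ∀ {g P b} (Inv : ℕ → Predicate) →
    (∀ {s} → Inv 0 s → ¬ Holds g (memory s)) →
    (∀ d {s} → Inv (suc d) s → Holds g (memory s) × Ensures P s (Inv d) b) →
    ∀ d {s} → Inv d s → Ensures (while g P) s (Inv 0) (whileBound g b d)
  while-rule {g} Inv exit step zero    inv =
    _ , _ , while-false (exit inv) , ℕ.m≤m+n (costᵍ g) 0 , inv
  while-rule {g} {P} {b} Inv exit step (suc d) inv with step d inv
  ... | h , s′ , t , P⇓ , t≤b , inv′ with while-rule {g} {P} {b} Inv exit step d inv′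
  ... | s″ , t′ , rest⇓ , t′≤ , inv″ =
    s″ , _ , while-true h P⇓ rest⇓ ,
    ℕ.≤-trans (ℕ.+-mono-≤ (ℕ.+-monoʳ-≤ (costᵍ g) t≤b) t′≤)
      (ℕ.≤-reflexive (rearrange (costᵍ g) b (d ℕ.* (costᵍ g ℕ.+ b)))) , inv″
    where
    rearrange : ∀ g b r → (g ℕ.+ b) ℕ.+ (g ℕ.+ r) ≡ g ℕ.+ ((g ℕ.+ b) ℕ.+ r)
    rearrange = solve-∀

-- The equilibrium string and the program.

letters⟨_,_⟩ : Action → Kind → ℕ → List Symbol
letters⟨ u , v ⟩ zero    = []
letters⟨ u , v ⟩ (suc d) = inj₁ u ∷ inj₂ v ∷ letters⟨ u , v ⟩ d

schedule-longFirst : ∀ n m → m ℕ.≤ n →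
  schedule (replicate n E) (longFirst n m) ≡ letters⟨ E , long ⟩ m ++ letters⟨ E , short ⟩ (n ℕ.∸ m)
schedule-longFirst zero    zero    _           = ≡.refl
schedule-longFirst (suc n) zero    _           =
  ≡.cong (λ s → inj₁ E ∷ inj₂ short ∷ s) (schedule-longFirst n zero ℕ.z≤n)
schedule-longFirst (suc n) (suc m) (ℕ.s≤s m≤n) =
  ≡.cong (λ s → inj₁ E ∷ inj₂ long ∷ s) (schedule-longFirst n m m≤n)

-- Four blocks of one repeated pair of letters: the schedule can be printed from four counters
-- without storing it.
schedule-worstCase : ∀ {n} (a : Fin (suc n)) {k m} → Feasible n (toℕ a) k m →
  schedule (twoPhase n a) (worstCase a k m) ≡
  letters⟨ T , long ⟩ k ++ letters⟨ T , short ⟩ (toℕ a ℕ.∸ k) ++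
  letters⟨ E , long ⟩ m ++ letters⟨ E , short ⟩ (n ℕ.∸ toℕ a ℕ.∸ m)
schedule-worstCase {n} zero {zero} (feasible _ m≤n) = schedule-longFirst n _ m≤n
schedule-worstCase {suc n} (suc a) {zero} (feasible _ (ℕ.s≤s a+m≤n)) =
  ≡.cong (λ s → inj₁ T ∷ inj₂ short ∷ s) (schedule-worstCase a (feasible ℕ.z≤n a+m≤n))
schedule-worstCase {suc n} (suc a) {suc k} (feasible (ℕ.s≤s k≤a) (ℕ.s≤s a+m≤n)) =
  ≡.cong (λ s → inj₁ T ∷ inj₂ long ∷ s) (schedule-worstCase a (feasible k≤a a+m≤n))

-- Memory layout: n, p, x in cells 0–2, a in 3, the current k and m in 4 and
-- 5, the best value for this a with its k and m in 6–8, the best value over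
-- the previous a with its a, k and m in 9–12.

optimumᵉ excessᵉ valueᵉ : Expr
optimumᵉ = (cell 1 ⊛ (cell 0 ⊛ (cell 0 ⊕ lit 1)) ⊕
            cell 2 ⊛ ((cell 4 ⊕ cell 5) ⊛ (cell 4 ⊕ cell 5 ⊕ lit 1))) ⊘ lit 2
excessᵉ  = cell 3 ⊛ cell 0 ⊖ (cell 3 ⊖ cell 4) ⊛ (cell 3 ⊖ cell 4 ⊖ lit 1) ⊘ lit 2 ⊕
           cell 2 ⊛ (cell 5 ⊛ (cell 0 ⊖ cell 3 ⊖ cell 5))
valueᵉ   = excessᵉ ⊘ optimumᵉ

preferUntestedᵍ : Guard
preferUntestedᵍ =
  cell 3 ⊖ cell 4 ⊖ lit 1 ⊲ cell 2 ⊛ (cell 0 ⊖ cell 3 ⊖ cell 5 ⊖ cell 5 ⊖ lit 1)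

-- `grow` compares k with a but never m with n - a, which `prefer⇒room` justifies. `improve` keeps
-- the larger value, as the adversary maximizes.
start grow improve scan : Program
start   = put 4 (lit 0) ⨾ put 5 (lit 0) ⨾ put 6 valueᵉ ⨾ put 7 (lit 0) ⨾ put 8 (lit 0)
grow    = if (cell 4 ⊲ cell 3)
            (if preferUntestedᵍ (put 5 (lit 1 ⊕ cell 5)) (put 4 (lit 1 ⊕ cell 4)))
            (put 5 (lit 1 ⊕ cell 5))
improve = if (cell 6 ⊲ valueᵉ) (put 6 valueᵉ ⨾ put 7 (cell 4) ⨾ put 8 (cell 5)) skip
scan    = start ⨾ while (cell 4 ⊕ cell 5 ⊲ cell 0) (grow ⨾ improve)

-- The smaller of the best-reply values wins, as the algorithm minimizes.
crown compete : Program
crown   = put 9 (cell 6) ⨾ put 10 (cell 3) ⨾ put 11 (cell 7) ⨾ put 12 (cell 8)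

compete = if (cell 6 ⊲ cell 9) crown skip ⨾ put 3 (lit 1 ⊕ cell 3)

-- Cell 3 is 0 initially, so the scan before the loop treats a = 0 and supplies the first champion;
-- no infinite sentinel is required.
tournament : Program
tournament =
  scan ⨾ (crown ⨾ put 3 (lit 1)) ⨾ while (cell 3 ⊲ lit 1 ⊕ cell 0) (scan ⨾ compete)

emitGuard : ℕ → Guard
emitGuard i = lit 0 ⊲ cell i

emitBody : ℕ → Action → Kind → Program
emitBody i u v = emit (inj₁ u) ⨾ emit (inj₂ v) ⨾ put i (cell i ⊖ lit 1)

emitPairs : ℕ → Action → Kind → Program
emitPairs i u v = while (emitGuard i) (emitBody i u v)

-- Cells 4 and 5 are free by now and receive the numbers of tested and untested short jobs. The
-- loops count down cells 11, 4, 12 and 5; cell 10 survives them and finally replaces n in cell 0.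
prepare printing : Program
prepare  = put 4 (cell 10 ⊖ cell 11) ⨾ put 5 (cell 0 ⊖ cell 10 ⊖ cell 12)
printing =
  prepare ⨾ emitPairs 11 T long ⨾ emitPairs 4 T short ⨾ emitPairs 12 E long ⨾ emitPairs 5 E short ⨾
  put 0 (cell 10)

-- The time of emitPairs depends neither on the cell nor on the letters.

scanBound tournamentBound emitBound printingBound : ℕ → ℕ
scanBound n = bound start ℕ.+ whileBound (cell 4 ⊕ cell 5 ⊲ cell 0) (bound (grow ⨾ improve)) n
tournamentBound n =
  scanBound n ℕ.+ (bound (crown ⨾ put 3 (lit 1)) ℕ.+
    whileBound (cell 3 ⊲ lit 1 ⊕ cell 0) (scanBound n ℕ.+ bound compete) n)
emitBound n = whileBound (emitGuard 0) (bound (emitBody 0 T long)) n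
printingBound n =
  bound prepare ℕ.+ (emitBound n ℕ.+ (emitBound n ℕ.+ (emitBound n ℕ.+ (emitBound n ℕ.+ bound (put 0 (cell 10))))))

scanBound-growth : GrowsAs 1 scanBound
scanBound-growth = constant 1 (bound start) ⊞
  whileBound-growth (cell 4 ⊕ cell 5 ⊲ cell 0) (constant 0 (bound (grow ⨾ improve)))

tournamentBound-growth : GrowsAs 2 tournamentBound
tournamentBound-growth =
  raise scanBound-growth ⊞
  (constant 2 (bound (crown ⨾ put 3 (lit 1))) ⊞
   whileBound-growth (cell 3 ⊲ lit 1 ⊕ cell 0) (scanBound-growth ⊞ constant 1 (bound compete)))

emitBound-growth : GrowsAs 1 emitBound
emitBound-growth = whileBound-growth (emitGuard 0) (constant 0 (bound (emitBody 0 T long)))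

printingBound-growth : GrowsAs 1 printingBound
printingBound-growth =
  constant 1 (bound prepare) ⊞ (emitBound-growth ⊞ (emitBound-growth ⊞ (emitBound-growth ⊞
    (emitBound-growth ⊞ constant 1 (bound (put 0 (cell 10)))))))

≡ᵇ-refl : ∀ i → (i ℕ.≡ᵇ i) ≡ true
≡ᵇ-refl zero    = ≡.refl
≡ᵇ-refl (suc i) = ≡ᵇ-refl i

-- Correctness of the program.

module Correctness {c ℓ₁ ℓ₂} (F : OrderedField c ℓ₁ ℓ₂) (p x : OrderedField.Carrier F)
  (0<p : OrderedField._<_ F (OrderedField.0# F) p)
  (0<x : OrderedField._<_ F (OrderedField.0# F) x)
  (n : ℕ) (1≤n : 1 ℕ.≤ n) where

  open OrderedField F hiding (zero)
  open OrderedFieldProperties F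
  open Machine F
  open Values F
  open Game F using (Equilibrium)
  open GameProperties F p x 0<p 0<x
  open ProgramLogic F

  suc-cell : ∀ k {y} → y ≈ fromℕ k → fromℕ 1 + y ≈ fromℕ (suc k)
  suc-cell k y≈ = +-cong fromℕ-1 y≈

  pred-cell : ∀ k {y} → y ≈ fromℕ (suc k) → y - fromℕ 1 ≈ fromℕ k
  pred-cell k {y} y≈ = trans (-‿cong₂ y≈ refl)
    (solve 1 (λ k → con (+ 1) :+ k :- :1 := k) refl (fromℕ k))
    where open RingSolver

  fromℕ-∸ : ∀ {k a} → k ℕ.≤ a → ∀ {y z} → y ≈ fromℕ a → z ≈ fromℕ k → y - z ≈ fromℕ (a ℕ.∸ k)
  fromℕ-∸ {k} {a} k≤a {y} {z} y≈ z≈ = begin-equality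
    y - z                                     ≈⟨ -‿cong₂ y≈ z≈ ⟩
    fromℕ a - fromℕ k                         ≡⟨ ≡.cong (λ a → fromℕ a - fromℕ k) (ℕ.m∸n+n≡m k≤a) ⟨
    fromℕ (a ℕ.∸ k ℕ.+ k) - fromℕ k           ≈⟨ +-congʳ (fromℕ-+ (a ℕ.∸ k) k) ⟩
    fromℕ (a ℕ.∸ k) + fromℕ k - fromℕ k       ≈⟨ solve 2 (λ d k → d :+ k :- k := d) refl (fromℕ (a ℕ.∸ k)) (fromℕ k) ⟩
    fromℕ (a ℕ.∸ k)                           ∎
    where open RingSolver
          open ≤-Reasoning

  <-cong : ∀ {y y′ z z′} → y ≈ y′ → z ≈ z′ → y < z → y′ < z′
  <-cong y≈ z≈ y<z = <-respˡ y≈ (<-respʳ z≈ y<z)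

  value-cong : ∀ {X X′ P P′ N N′ A A′ K K′ M M′} → P ≈ P′ → X ≈ X′ → N ≈ N′ → A ≈ A′ → K ≈ K′ → M ≈ M′ →
               value P X N A K M ≈ value P′ X′ N′ A′ K′ M′
  value-cong P≈ X≈ N≈ A≈ K≈ M≈ = ÷-cong
    (+-cong (-‿cong₂ (*-cong A≈ N≈)
               (*-congʳ (*-cong (-‿cong₂ A≈ K≈) (+-congʳ (-‿cong₂ A≈ K≈)))))
            (*-cong X≈ (*-cong M≈ (-‿cong₂ (-‿cong₂ N≈ A≈) M≈))))
    (*-congʳ (+-cong (*-cong P≈ (pronic-cong N≈)) (*-cong X≈ (pronic-cong (+-cong K≈ M≈)))))

  -- The invariants speak of cell contents rather than states: after a write to another cell the
  -- content reduces to the old one, and the old proof can be reused as it is.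
  record Inputs (y₀ y₁ y₂ : Carrier) : Set (c ⊔ ℓ₁ ⊔ ℓ₂) where
    constructor inputs
    field
      n-cell : y₀ ≈ fromℕ n
      p-cell : y₁ ≈ p
      x-cell : y₂ ≈ x

  open Inputs

  record Frontier (a ℓ : ℕ) (y₄ y₅ : Carrier) : Set (c ⊔ ℓ₁ ⊔ ℓ₂) where
    constructor frontier
    field
      {k m}    : ℕ
      feas     : Feasible n a k m
      balanced : Balanced n a k m
      k+m≡ℓ    : k ℕ.+ m ≡ ℓ
      k-cell   : y₄ ≈ fromℕ k
      m-cell   : y₅ ≈ fromℕ m

  record BestBelow (a ℓ : ℕ) (y₆ y₇ y₈ : Carrier) : Set (c ⊔ ℓ₁ ⊔ ℓ₂) where
    constructor bestBelow
    field
      {k m}   : ℕ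
      feas    : Feasible n a k m
      best    : ∀ {k′ m′} → Feasible n a k′ m′ → k′ ℕ.+ m′ ℕ.< ℓ → W n a k′ m′ ≤ W n a k m
      W-cell  : y₆ ≈ W n a k m
      k-cell  : y₇ ≈ fromℕ k
      m-cell  : y₈ ≈ fromℕ m

  -- Frame is an arbitrary fact about the cells that scan leaves alone.

  module Scanning (Frame : (y₉ y₁₀ y₁₁ y₁₂ : Carrier) → Set (c ⊔ ℓ₁ ⊔ ℓ₂)) (a : ℕ) (a≤n : a ℕ.≤ n) where

    -- Two indices are needed because `grow` moves the frontier to the next line before `improve`
    -- takes that line into account.
    record Scan (ℓ b : ℕ) (s : State) : Set (c ⊔ ℓ₁ ⊔ ℓ₂) where
      constructor scanState
      field
        silent : output s ≡ []
        input  : Inputs (memory s 0) (memory s 1) (memory s 2)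
        a-cell : memory s 3 ≈ fromℕ a
        front  : Frontier a ℓ (memory s 4) (memory s 5)
        best   : BestBelow a b (memory s 6) (memory s 7) (memory s 8)
        frame  : Frame (memory s 9) (memory s 10) (memory s 11) (memory s 12)

    -- By `W-balanced` the frontier pair dominates its whole line, so one evaluation settles all
    -- pairs with k + m = ℓ.
    improve-correct : ∀ ℓ {s} → Scan ℓ ℓ s → wp improve (Scan ℓ (suc ℓ)) s
    improve-correct ℓ {s} (scanState o (inputs n≈ p≈ x≈) a≈ (frontier {k} {m} feas bal k+m≡ℓ k≈ m≈)
                             (bestBelow {k*} {m*} feas* best* W≈ k*≈ m*≈) fr) =
      (λ better → scanState o (inputs n≈ p≈ x≈) a≈ (frontier feas bal k+m≡ℓ k≈ m≈)
         (bestBelow feas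
           (update (λ W′≤W* → ≤-trans W′≤W* (<⇒≤ (<-cong W≈ current better))) ≤-refl)
           current k≈ m≈) fr) ,
      (λ worse → scanState o (inputs n≈ p≈ x≈) a≈ (frontier feas bal k+m≡ℓ k≈ m≈)
         (bestBelow feas*
           (update (λ W′≤W* → W′≤W*) (≮⇒≥ (λ better → worse (<-cong (sym W≈) (sym current) better))))
           W≈ k*≈ m*≈) fr)
      where
      current : ⟦ valueᵉ ⟧ (memory s) ≈ W n a k m
      current = value-cong p≈ x≈ n≈ a≈ k≈ m≈
      update : ∀ {y} → (∀ {z} → z ≤ W n a k* m* → z ≤ y) → W n a k m ≤ y →
               ∀ {k′ m′} → Feasible n a k′ m′ → k′ ℕ.+ m′ ℕ.< suc ℓ → W n a k′ m′ ≤ y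
      update old new feas′ (ℕ.s≤s k′+m′≤ℓ) with ℕ.m≤n⇒m<n∨m≡n k′+m′≤ℓ
      ... | inj₁ k′+m′<ℓ = old (best* feas′ k′+m′<ℓ)
      ... | inj₂ k′+m′≡ℓ = ≤-trans
        (W-balanced 1≤n bal feas feas′ (≡.trans k′+m′≡ℓ (≡.sym k+m≡ℓ))) new

    start-correct : ∀ {s} → output s ≡ [] → Inputs (memory s 0) (memory s 1) (memory s 2) →
      memory s 3 ≈ fromℕ a → Frame (memory s 9) (memory s 10) (memory s 11) (memory s 12) →
      wp start (Scan 0 1) s
    start-correct o (inputs n≈ p≈ x≈) a≈ fr =
      scanState o (inputs n≈ p≈ x≈) a≈ (frontier feas₀ (balanced-start n a) ≡.refl refl refl)
        (bestBelow feas₀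
          (λ feas′ k′+m′<1 → W-balanced 1≤n (balanced-start n a) feas₀ feas′ (ℕ.n<1⇒n≡0 k′+m′<1))
          (value-cong p≈ x≈ n≈ a≈ refl refl) refl refl)
        fr
      where
      feas₀ : Feasible n a 0 0
      feas₀ = feasible ℕ.z≤n (≡.subst (ℕ._≤ n) (≡.sym (ℕ.+-identityʳ a)) a≤n)

    grow-correct : ∀ ℓ {s} → ℓ ℕ.< n → Scan ℓ (suc ℓ) s → wp grow (Scan (suc ℓ) (suc ℓ)) s
    grow-correct ℓ {s} ℓ<n (scanState o (inputs n≈ p≈ x≈) a≈ (frontier {k} {m} feas bal ≡.refl k≈ m≈) best fr) =
      (λ k<a →
         (λ pref → untest (λ _ → <-cong gap≈ gain≈ pref)) ,
         (λ ¬pref → scanState o (inputs n≈ p≈ x≈) a≈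
            (frontier (feasible (fromℕ-cancel-< (<-cong k≈ a≈ k<a)) (Feasible.a+m≤n feas))
              (balanced-tested bal (λ pref → ¬pref (<-cong (sym gap≈) (sym gain≈) pref)))
              ≡.refl (suc-cell k k≈) m≈)
            best fr)) ,
      (λ k≮a → untest (λ k<a → contradiction (<-cong (sym k≈) (sym a≈) (fromℕ-mono-< k<a)) k≮a))
      where
      μ = memory s
      gap≈ : μ 3 - μ 4 - fromℕ 1 ≈ fromℕ a - fromℕ k - fromℕ 1
      gap≈ = +-congʳ (-‿cong₂ a≈ k≈)
      gain≈ : swapGain (μ 2) (μ 0) (μ 3) (μ 5) ≈ swapGain x (fromℕ n) (fromℕ a) (fromℕ m)
      gain≈ = *-cong x≈ (+-congʳ (-‿cong₂ (-‿cong₂ (-‿cong₂ n≈ a≈) m≈) m≈))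
      untest : (k ℕ.< a → Prefer-untested n a k m) → wp (put 5 (lit 1 ⊕ cell 5)) (Scan (suc ℓ) (suc ℓ)) s
      untest pref = scanState o (inputs n≈ p≈ x≈) a≈
        (frontier (feasible-untested feas ℓ<n pref) (balanced-untested bal pref)
          (ℕ.+-suc k m) k≈ (suc-cell m m≈))
        best fr

    Loop : ℕ → Predicate
    Loop d s = ∃[ ℓ ] ℓ ℕ.+ d ≡ n × Scan ℓ (suc ℓ) s

    guard-cells : ∀ {ℓ s} → Scan ℓ (suc ℓ) s → memory s 4 + memory s 5 ≈ fromℕ ℓ
    guard-cells (scanState _ _ _ (frontier {k} {m} _ _ ≡.refl k≈ m≈) _ _) =
      trans (+-cong k≈ m≈) (sym (fromℕ-+ k m))

    Scanned : Predicate
    Scanned = Scan n (suc n)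

    scan-correct : ∀ {s} → output s ≡ [] → Inputs (memory s 0) (memory s 1) (memory s 2) →
      memory s 3 ≈ fromℕ a → Frame (memory s 9) (memory s 10) (memory s 11) (memory s 12) →
      Ensures scan s Scanned (scanBound n)
    scan-correct o ins a≈ fr =
      wp-rule start (start-correct o ins a≈ fr) then λ sc →
      while-rule Loop exit step n (0 , ≡.refl , sc) ⇒ finished
      where
      finished : ∀ {s} → Loop 0 s → Scanned s
      finished {s} (ℓ , ℓ+0≡n , sc) =
        ≡.subst (λ ℓ → Scan ℓ (suc ℓ) s) (≡.trans (≡.sym (ℕ.+-identityʳ ℓ)) ℓ+0≡n) sc
      exit : ∀ {s} → Loop 0 s → ¬ (memory s 4 + memory s 5 < memory s 0)
      exit (ℓ , ℓ+0≡n , sc) k+m<n = ℕ.<-irrefl (≡.trans (≡.sym (ℕ.+-identityʳ ℓ)) ℓ+0≡n)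
        (fromℕ-cancel-< (<-cong (guard-cells sc) (n-cell (Scan.input sc)) k+m<n))
      step : ∀ d {s} → Loop (suc d) s → (memory s 4 + memory s 5 < memory s 0) ×
             Ensures (grow ⨾ improve) s (Loop d) (bound (grow ⨾ improve))
      step d (ℓ , ℓ+1+d≡n , sc) =
        <-cong (sym (guard-cells sc)) (sym (n-cell (Scan.input sc))) (fromℕ-mono-< ℓ<n) ,
        (wp-rule grow (grow-correct ℓ ℓ<n sc) then λ sc′ →
         wp-rule improve (improve-correct (suc ℓ) sc′)) ⇒ λ sc″ →
        suc ℓ , ≡.trans (≡.sym (ℕ.+-suc ℓ d)) ℓ+1+d≡n , sc″
        where
        ℓ<n : ℓ ℕ.< n
        ℓ<n = ≡.subst (ℓ ℕ.<_) ℓ+1+d≡n (ℕ.m<m+n ℓ (ℕ.s≤s ℕ.z≤n))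

  -- The tournament over a.

  feasible⇒k+m≤n : ∀ {a k m} → Feasible n a k m → k ℕ.+ m ℕ.≤ n
  feasible⇒k+m≤n (feasible k≤a a+m≤n) = ℕ.≤-trans (ℕ.+-monoˡ-≤ _ k≤a) a+m≤n

  record Champion (b : ℕ) (y₉ y₁₀ y₁₁ y₁₂ : Carrier) : Set (c ⊔ ℓ₁ ⊔ ℓ₂) where
    constructor champion
    field
      {a k m}   : ℕ
      a≤n       : a ℕ.≤ n
      feas      : Feasible n a k m
      bestReply : BestReply n a k m
      optimal   : ∀ {a′} → a′ ℕ.< b →
                  ∃₂ λ k′ m′ → Feasible n a′ k′ m′ × W n a k m ≤ W n a′ k′ m′
      W-cell    : y₉ ≈ W n a k m
      a-cell    : y₁₀ ≈ fromℕ a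
      k-cell    : y₁₁ ≈ fromℕ k
      m-cell    : y₁₂ ≈ fromℕ m

  record Standings (b : ℕ) (s : State) : Set (c ⊔ ℓ₁ ⊔ ℓ₂) where
    constructor standings
    field
      silent : output s ≡ []
      input  : Inputs (memory s 0) (memory s 1) (memory s 2)
      a-cell : memory s 3 ≈ fromℕ b
      leader : Champion b (memory s 9) (memory s 10) (memory s 11) (memory s 12)

  Unframed : (y₉ y₁₀ y₁₁ y₁₂ : Carrier) → Set (c ⊔ ℓ₁ ⊔ ℓ₂)
  Unframed _ _ _ _ = Lift _ ⊤

  open Scanning using (Scanned; scanState; scan-correct)

  first-correct : ∀ {s} → Scanned Unframed 0 ℕ.z≤n s → wp (crown ⨾ put 3 (lit 1)) (Standings 1) s
  first-correct (scanState o ins a≈ _ (bestBelow feas best W≈ k≈ m≈) _) =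
    standings o ins refl
      (champion ℕ.z≤n feas (λ feas′ → best feas′ (ℕ.s≤s (feasible⇒k+m≤n feas′)))
        (λ { (ℕ.s≤s ℕ.z≤n) → _ , _ , feas , ≤-refl }) W≈ a≈ k≈ m≈)

  -- A new champion has a smaller value, so the replies witnessing optimality against earlier a′
  -- still serve by transitivity; the pair just found is the witness for a itself.
  compete-correct : ∀ a (a≤n : a ℕ.≤ n) {s} → Scanned (Champion a) a a≤n s →
                    wp compete (Standings (suc a)) s
  compete-correct a a≤n {s} (scanState o ins a≈ _ (bestBelow {k} {m} feas best W≈ k≈ m≈)
    (champion {a°} {k°} {m°} a°≤n feas° bestReply° optimal° W°≈ a°≈ k°≈ m°≈)) =
    (λ better → standings o ins (suc-cell a a≈)
      (champion a≤n feas (λ feas′ → best feas′ (ℕ.s≤s (feasible⇒k+m≤n feas′)))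
        (extend (≤-trans (<⇒≤ (<-cong W≈ W°≈ better))) ≤-refl) W≈ a≈ k≈ m≈)) ,
    (λ worse → standings o ins (suc-cell a a≈)
      (champion a°≤n feas° bestReply°
        (extend (λ W°≤W′ → W°≤W′) (≮⇒≥ (λ better → worse (<-cong (sym W≈) (sym W°≈) better))))
        W°≈ a°≈ k°≈ m°≈))
    where
    extend : ∀ {y} → (∀ {z} → W n a° k° m° ≤ z → y ≤ z) → y ≤ W n a k m →
      ∀ {a′} → a′ ℕ.< suc a → ∃₂ λ k′ m′ → Feasible n a′ k′ m′ × y ≤ W n a′ k′ m′
    extend old new (ℕ.s≤s a′≤a) with ℕ.m≤n⇒m<n∨m≡n a′≤a
    ... | inj₂ ≡.refl = k , m , feas , new
    ... | inj₁ a′<a with k′ , m′ , feas′ , W°≤W′ ← optimal° a′<a = k′ , m′ , feas′ , old W°≤W′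

  tournament-correct : Ensures tournament (initial n p x) (Standings (suc n)) (tournamentBound n)
  tournament-correct =
    scan-correct Unframed 0 ℕ.z≤n ≡.refl (inputs refl refl refl) refl (lift tt) then λ sc →
    wp-rule (crown ⨾ put 3 (lit 1)) (first-correct sc) then λ st →
    while-rule Loop exit step n (1 , ≡.refl , st) ⇒ finished
    where
    Loop : ℕ → Predicate
    Loop d s = ∃[ a ] a ℕ.+ d ≡ suc n × Standings a s
    finished : ∀ {s} → Loop 0 s → Standings (suc n) s
    finished {s} (a , a+0≡1+n , st) =
      ≡.subst (λ a → Standings a s) (≡.trans (≡.sym (ℕ.+-identityʳ a)) a+0≡1+n) st
    exit : ∀ {s} → Loop 0 s → ¬ (memory s 3 < fromℕ 1 + memory s 0)
    exit l a<1+n with standings _ ins a≈ _ ← finished l =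
      ℕ.<-irrefl ≡.refl (fromℕ-cancel-< {suc n} {suc n} (<-cong a≈ (suc-cell n (n-cell ins)) a<1+n))
    step : ∀ d {s} → Loop (suc d) s → (memory s 3 < fromℕ 1 + memory s 0) ×
           Ensures (scan ⨾ compete) s (Loop d) (scanBound n ℕ.+ bound compete)
    step d (a , a+1+d≡1+n , standings o ins a≈ leader) =
      <-cong (sym a≈) (sym (suc-cell n (n-cell ins))) (fromℕ-mono-< (ℕ.s≤s a≤n)) ,
      (scan-correct (Champion a) a a≤n o ins a≈ leader then λ sc →
       wp-rule compete (compete-correct a a≤n sc)) ⇒ λ st →
      suc a , ≡.trans (≡.sym (ℕ.+-suc a d)) a+1+d≡1+n , st
      where
      a≤n : a ℕ.≤ n
      a≤n = ℕ.≤-pred (≡.subst (a ℕ.<_) a+1+d≡1+n (ℕ.m<m+n a (ℕ.s≤s ℕ.z≤n)))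

  -- Printing the schedule.

  module _ (i : ℕ) (u : Action) (v : Kind) where

    -- Distinctness of cells is phrased with the Boolean test used by memory updates, so that for
    -- literal cells it is proved by `refl`.
    record Emitted (d : ℕ) (s₀ s : State) : Set (c ⊔ ℓ₁ ⊔ ℓ₂) where
      constructor emitted
      field
        written   : output s ≡ output s₀ ++ letters⟨ u , v ⟩ d
        unchanged : ∀ j → (i ℕ.≡ᵇ j) ≡ false → memory s j ≡ memory s₀ j

    emitPairs-correct : ∀ d {s₀} → memory s₀ i ≈ fromℕ d →
      Ensures (emitPairs i u v) s₀ (Emitted d s₀) (whileBound (emitGuard i) (bound (emitBody i u v)) d)
    emitPairs-correct d {s₀} d≈ =
      while-rule Loop exit step d (lift ≡.refl , d≈ , λ _ _ → ≡.refl) ⇒ λ (lift w , _ , unch) →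
      emitted (≡.trans (≡.sym (List.++-identityʳ _)) w) unch
      where
      Loop : ℕ → Predicate
      -- What is written followed by what is still to be written stays constant.
      Loop e s = Lift (c ⊔ ℓ₁ ⊔ ℓ₂) (output s ++ letters⟨ u , v ⟩ e ≡ output s₀ ++ letters⟨ u , v ⟩ d) ×
                 memory s i ≈ fromℕ e × (∀ j → (i ℕ.≡ᵇ j) ≡ false → memory s j ≡ memory s₀ j)
      exit : ∀ {s} → Loop 0 s → ¬ (0# < memory s i)
      exit (_ , 0≈ , _) 0<0 = <-irrefl refl (<-respʳ 0≈ 0<0)
      step : ∀ e {s} → Loop (suc e) s → (0# < memory s i) ×
             Ensures (emitBody i u v) s (Loop e) (bound (emitBody i u v))
      step e {s} (lift w , e≈ , unch) = <-respʳ (sym e≈) (0<fromℕ-suc e) ,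
        wp-rule (emitBody i u v) (
          lift (≡.trans (≡.trans (List.++-assoc (output s ∷ʳ inj₁ u) (inj₂ v ∷ []) _)
                                 (List.++-assoc (output s) (inj₁ u ∷ []) _)) w) ,
          trans (reflexive updated) (pred-cell e e≈) ,
          λ j i≢j → ≡.trans (other j i≢j) (unch j i≢j))
        where
        μ = memory s
        y = μ i - fromℕ 1
        -- The cell is a variable here, so the lookup does not reduce by itself.
        updated : (μ [ i ≔ y ]) i ≡ y
        updated rewrite ≡ᵇ-refl i = ≡.refl
        other : ∀ j → (i ℕ.≡ᵇ j) ≡ false → (μ [ i ≔ y ]) j ≡ μ j
        other j i≢j rewrite i≢j = ≡.refl

  record Result (s : State) : Set (c ⊔ ℓ₁ ⊔ ℓ₂) where
    constructor result
    field
      {a}         : Fin (suc n)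
      {v}         : Vec Kind n
      equil       : Equilibrium p x n a v
      output≡     : output s ≡ schedule (twoPhase n a) v
      a-cell      : memory s 0 ≈ fromℕ (toℕ a)

  emitPairs-within : ∀ i u v {d} → d ℕ.≤ n → ∀ {s₀} → memory s₀ i ≈ fromℕ d →
    Ensures (emitPairs i u v) s₀ (Emitted i u v d s₀) (emitBound n)
  emitPairs-within i u v d≤n d≈ =
    weaken (ℕ.+-monoʳ-≤ (costᵍ (emitGuard i)) (ℕ.*-monoˡ-≤ _ d≤n)) (emitPairs-correct i u v _ d≈)

  Prepared : (a k m : ℕ) → Predicate
  Prepared a k m s = Lift (c ⊔ ℓ₁ ⊔ ℓ₂) (output s ≡ []) × memory s 10 ≈ fromℕ a × memory s 11 ≈ fromℕ k ×
    memory s 4 ≈ fromℕ (a ℕ.∸ k) × memory s 12 ≈ fromℕ m × memory s 5 ≈ fromℕ (n ℕ.∸ a ℕ.∸ m)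

  -- Each loop alters only its own counter; `at` carries the later counters and cell 10 through it.
  -- The number a becomes an element of `Fin (suc n)` only here.
  printing-correct : ∀ {s} → Standings (suc n) s → Ensures printing s Result (printingBound n)
  printing-correct {s₀} (standings o ins _ (champion {a} {k} {m} a≤n feas bestReply optimal _ a≈ k≈ m≈)) =
    wp-rule prepare {R = Prepared a k m}
      (lift o , a≈ , k≈ , fromℕ-∸ k≤a a≈ k≈ , m≈ ,
       fromℕ-∸ m≤n∸a (fromℕ-∸ a≤n (n-cell ins) a≈) m≈) then λ { {s₁} (lift o₁ , a≈ , k≈ , a∸k≈ , m≈ , rest≈) →
    emitPairs-within 11 T long k≤n k≈ then λ { {s₂} e₂@(emitted w₂ _) →
    emitPairs-within 4 T short a∸k≤n (at e₂ 4 ≡.refl a∸k≈) then λ { {s₃} e₃@(emitted w₃ _) →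
    emitPairs-within 12 E long m≤n (at e₃ 12 ≡.refl (at e₂ 12 ≡.refl m≈)) then λ { {s₄} e₄@(emitted w₄ _) →
    emitPairs-within 5 E short rest≤n (at e₄ 5 ≡.refl (at e₃ 5 ≡.refl (at e₂ 5 ≡.refl rest≈)))
      then λ { {s₅} e₅@(emitted w₅ _) →
    wp-rule (put 0 (cell 10)) (result {a = aᶠ}
      (equilibrium 1≤n aᶠ feasᶠ bestReplyᶠ optimalᶠ)
      (begin
        output s₅
          ≡⟨ w₅ ⟩
        output s₄ ++ es
          ≡⟨ ≡.cong (_++ es) w₄ ⟩
        (output s₃ ++ el) ++ es
          ≡⟨ ≡.cong (λ o → (o ++ el) ++ es) w₃ ⟩
        ((output s₂ ++ ts) ++ el) ++ es
          ≡⟨ ≡.cong (λ o → ((o ++ ts) ++ el) ++ es) (≡.trans w₂ (≡.cong (_++ tl) o₁)) ⟩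
        ((tl ++ ts) ++ el) ++ es
          ≡⟨ List.++-assoc (tl ++ ts) el es ⟩
        (tl ++ ts) ++ (el ++ es)
          ≡⟨ List.++-assoc tl ts (el ++ es) ⟩
        tl ++ ts ++ el ++ es
          ≡⟨ ≡.cong (λ a → letters⟨ T , long ⟩ k ++ letters⟨ T , short ⟩ (a ℕ.∸ k) ++
               letters⟨ E , long ⟩ m ++ letters⟨ E , short ⟩ (n ℕ.∸ a ℕ.∸ m)) toℕ-aᶠ ⟨
        _
          ≡⟨ schedule-worstCase aᶠ feasᶠ ⟨
        schedule (twoPhase n aᶠ) (worstCase aᶠ k m) ∎)
      (trans (at e₅ 10 ≡.refl (at e₄ 10 ≡.refl (at e₃ 10 ≡.refl (at e₂ 10 ≡.refl a≈))))
             (reflexive (≡.cong fromℕ (≡.sym toℕ-aᶠ)))))}}}}}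
    where
    open ≡.≡-Reasoning
    open Feasible feas
    tl = letters⟨ T , long ⟩ k
    ts = letters⟨ T , short ⟩ (a ℕ.∸ k)
    el = letters⟨ E , long ⟩ m
    es = letters⟨ E , short ⟩ (n ℕ.∸ a ℕ.∸ m)
    k≤n : k ℕ.≤ n
    k≤n = ℕ.≤-trans k≤a a≤n
    a∸k≤n : a ℕ.∸ k ℕ.≤ n
    a∸k≤n = ℕ.≤-trans (ℕ.m∸n≤m a k) a≤n
    m≤n : m ℕ.≤ n
    m≤n = ℕ.m+n≤o⇒n≤o a a+m≤n
    m≤n∸a : m ℕ.≤ n ℕ.∸ a
    m≤n∸a = ℕ.m+n≤o⇒m≤o∸n m (≡.subst (ℕ._≤ n) (ℕ.+-comm a m) a+m≤n)
    rest≤n : n ℕ.∸ a ℕ.∸ m ℕ.≤ n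
    rest≤n = ℕ.≤-trans (ℕ.m∸n≤m (n ℕ.∸ a) m) (ℕ.m∸n≤m n a)
    aᶠ : Fin (suc n)
    aᶠ = fromℕ< (ℕ.s≤s a≤n)
    toℕ-aᶠ : toℕ aᶠ ≡ a
    toℕ-aᶠ = Fin.toℕ-fromℕ< (ℕ.s≤s a≤n)
    feasᶠ : Feasible n (toℕ aᶠ) k m
    feasᶠ = ≡.subst (λ a → Feasible n a k m) (≡.sym toℕ-aᶠ) feas
    bestReplyᶠ : BestReply n (toℕ aᶠ) k m
    bestReplyᶠ = ≡.subst (λ a → BestReply n a k m) (≡.sym toℕ-aᶠ) bestReply
    optimalᶠ : ∀ a′ → ∃₂ λ k′ m′ → Feasible n (toℕ a′) k′ m′ × W n (toℕ aᶠ) k m ≤ W n (toℕ a′) k′ m′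
    optimalᶠ a′ = ≡.subst
      (λ a → ∃₂ λ k′ m′ → Feasible n (toℕ a′) k′ m′ × W n a k m ≤ W n (toℕ a′) k′ m′)
      (≡.sym toℕ-aᶠ) (optimal (Fin.toℕ<n a′))
    at : ∀ {i u v d s s′ y} → Emitted i u v d s s′ →
         ∀ j → (i ℕ.≡ᵇ j) ≡ false → memory s j ≈ y → memory s′ j ≈ y
    at e j i≢j ≈y = trans (reflexive (Emitted.unchanged e j i≢j)) ≈y

theorem1 : ∀ {c ℓ₁ ℓ₂} (F : OrderedField c ℓ₁ ℓ₂) →
  let open OrderedField F
      open Machine F
      open Game F
  in
  ∃[ P ] ∃[ C ] (∀ (n : ℕ) (p x : Carrier) → 1 ℕ.≤ n → 0# < p → 0# < x →
    ∃[ s ] ∃[ t ]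
      (P ∶ initial n p x ⇓ s time t) × (t ℕ.≤ C ℕ.* n ℕ.^ 2) ×
      (∃[ a ] ∃[ v ]
        Equilibrium p x n a v ×
        (output s ≡ schedule (twoPhase n a) v) ×
        (memory s 0 ≈ fromℕ (toℕ a))))
theorem1 F = tournament ⨾ printing , GrowsAs.factor growth , λ n p x 1≤n 0<p 0<x →
  let open Correctness F p x 0<p 0<x n 1≤n
      s , t , run , t≤ , result {a} {v} equil output≡ a≈ = tournament-correct then printing-correct
  in s , t , run , ℕ.≤-trans t≤ (GrowsAs.f≤ growth n 1≤n) , a , v , equil , output≡ , a≈
  where
  open ProgramLogic F using (_then_)
  growth : GrowsAs 2 (λ n → tournamentBound n ℕ.+ printingBound n)
  growth = tournamentBound-growth ⊞ raise printingBound-growth
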